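{- For every graph $G$ of tree-width $t\geq 2$, we have $f_1(G) \leq \binom{t+1}{2}$ and $f_2(G)\leq 3\binom{t+1}{3}$.
   Context: All graphs are simple, finite and undirected. An induced forest in $G$ is an acyclic induced subgraph of $G$. For $k\geq 1$, a $k$-strong forest of $G$ is an induced forest in $G$ each of whose connected components has at least $k$ edges. An edge of $G$ is $k$-valid if it is contained in some $k$-strong forest of $G$. The $k$-strong induced arboricity $f_k(G)$ is the smallest number of $k$-strong forests of $G$ that together cover all $k$-valid edges of $G$ (so $f_k(G)=0$ if $G$ has no $k$-valid edges). -}

module Defs where

open import Data.Fin using (Fin; zero; suc; combine; remQuot)
import Data.Fin as Fin
open import Data.Fin.Properties using (any?; all?; injective⇒≤; remQuot-combine)
open import Data.Fin.Subset using (Subset; _∈_; _⊆_; Nonempty; ∣_∣; ⊥; ⁅_⁆; _∪_)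
open import Data.Fin.Subset.Properties
  using (_∈?_; _⊆?_; nonempty?; anySubset?; ∉⊥; p⊆p∪q; q⊆p∪q; x∈p∪q⁻; x∈⁅x⁆; x∈⁅y⁆⇒x≡y; p⊂q⇒∣p∣<∣q∣; ∣p∣≤n)
open import Data.List using (List; []; _∷_; _∷ʳ_; length; map; filter; allFin; cartesianProduct)
import Data.List as List
open import Data.List.Extrema.Nat using (max)
open import Data.List.Relation.Unary.Linked using (Linked; linked?)
open import Data.List.Relation.Unary.Unique.Propositional using (Unique)
import Data.List.Relation.Unary.All as All
import Data.List.Relation.Unary.AllPairs as AllPairs
open import Data.List.Membership.Propositional.Properties using (∈-lookup)
open import Data.List.Relation.Unary.Unique.DecPropositional using (unique?)
open import Data.Nat using (ℕ; zero; suc; _+_; _*_; _∸_; _≤_; _<_; _≤?_; z≤n; s≤s; s≤s⁻¹; NonZero)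
open import Data.Nat.Properties
  using (≤-trans; <⇒≱; +-identityʳ; +-suc; +-monoʳ-≤; m≤n+m; ≤-reflexive)
open import Data.Product using (∃; ∃-syntax; _×_; _,_; proj₁; proj₂; uncurry)
open import Data.Sum using (inj₁; inj₂)
open import Data.Vec using (Vec; []; _∷_; lookup; tabulate)
open import Data.Vec.Properties using (lookup∘tabulate)
open import Function using (_∘_)
open import Level using (Level; 0ℓ)
open import Relation.Binary using (Rel; Symmetric)
import Relation.Binary as B
open import Relation.Binary.Construct.Closure.ReflexiveTransitive using (Star; ε; _◅_; _◅◅_)
open import Relation.Binary.PropositionalEquality using (_≡_; refl; sym; cong; subst)
open import Relation.Nullary using (¬_; Dec; yes; no; contradiction)
open import Relation.Nullary.Decidable using (map′; ¬?; _×-dec_; _⊎-dec_; _→-dec_; decidable-stable)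
open import Relation.Unary using (Pred; Decidable; U)

private
  variable
    ℓ : Level
    n : ℕ

record Graph : Set₁ where
  field
    order      : ℕ
    Adj        : Rel (Fin order) 0ℓ
    adj?       : B.Decidable Adj
    adj-sym    : Symmetric Adj
    adj-irrefl : ∀ {v} → ¬ Adj v v

  Vertex : Set
  Vertex = Fin order

open Graph public using (order; Vertex)

-- The adjacency relation of the subgraph of G induced by P, still as a
-- relation on all vertices of G.
InducedAdj : (G : Graph) → Pred (Vertex G) 0ℓ → Rel (Vertex G) 0ℓ
InducedAdj G P u v = P u × P v × Graph.Adj G u v

Connected : (G : Graph) → Pred (Vertex G) 0ℓ → Set
Connected G P = ∀ u v → P u → P v → Star (InducedAdj G P) u v

-- The cycle x, xs₀, xs₁, …, x; the bound on the length excludes x, y, x.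
IsCycle : ∀ {A : Set} → Rel A 0ℓ → A → List A → Set
IsCycle R x xs = 2 ≤ length xs × Unique (x ∷ xs) × Linked R (x ∷ xs ∷ʳ x)

Acyclic : (G : Graph) → Pred (Vertex G) 0ℓ → Set
Acyclic G P = ¬ (∃[ x ] ∃[ xs ] IsCycle (InducedAdj G P) x xs)

IsLeast : Pred ℕ ℓ → Pred ℕ ℓ
IsLeast P m = P m × (∀ j → P j → m ≤ j)

IsTree : Graph → Set
IsTree T = NonZero (order T) × Connected T U × Acyclic T U

record TreeDecomposition (G : Graph) : Set₁ where
  field
    tree           : Graph
    isTree         : IsTree tree
    bag            : Vertex tree → Subset (order G)
    vertex-covered : ∀ v → ∃[ i ] v ∈ bag i
    edge-covered   : ∀ u v → Graph.Adj G u v → ∃[ i ] (u ∈ bag i × v ∈ bag i)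
    bags-connected : ∀ v → Connected tree (λ i → v ∈ bag i)

  -- Truncated subtraction matters only for the graph without vertices,
  -- which gets tree-width 0 instead of -1.
  width : ℕ
  width = max 0 (map (∣_∣ ∘ bag) (allFin (order tree))) ∸ 1

HasTreeWidth : Graph → ℕ → Set₁
HasTreeWidth G = IsLeast (λ w → ∃[ D ] TreeDecomposition.width {G} D ≡ w)

-- Induced subgraphs, in particular forests and their components, are given
-- by their vertex sets.
module _ (G : Graph) where
  open Graph G using (Adj; adj?)

  IsInducedForest : Subset (order G) → Set
  IsInducedForest S = Acyclic G (_∈ S)

  IsComponent : Subset (order G) → Subset (order G) → Set
  IsComponent S C =
    C ⊆ S × Nonempty C × Connected G (_∈ C) ×
    (∀ D → D ⊆ S → C ⊆ D → Connected G (_∈ D) → D ⊆ C)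

  -- Every edge is listed once, with its smaller endpoint first.
  edges : Subset (order G) → List (Vertex G × Vertex G)
  edges C = filter
    (λ (u , v) → (u Fin.<? v) ×-dec (u ∈? C) ×-dec (v ∈? C) ×-dec adj? u v)
    (cartesianProduct (allFin _) (allFin _))

  IsStrongForest : ℕ → Subset (order G) → Set
  IsStrongForest k S =
    IsInducedForest S × (∀ C → IsComponent S C → k ≤ length (edges C))

  EdgeIn : Vertex G → Vertex G → Subset (order G) → Set
  EdgeIn u v S = InducedAdj G (_∈ S) u v

  IsValid : ℕ → Vertex G → Vertex G → Set
  IsValid k u v = ∃[ S ] (IsStrongForest k S × EdgeIn u v S)

  IsCover : ℕ → ∀ {m} → Vec (Subset (order G)) m → Set
  IsCover k Fs =
    (∀ i → IsStrongForest k (lookup Fs i)) ×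
    (∀ u v → IsValid k u v → ∃[ i ] EdgeIn u v (lookup Fs i))

  HasCover : ℕ → ℕ → Set
  HasCover k m = ∃[ Fs ] IsCover k {m} Fs

-- Constructively, the least size of a cover exists because HasCover G k is
-- decidable.

least : {P : Pred ℕ ℓ} → Decidable P → ∀ m → P m → ∃ (IsLeast P)
least P? m pm with P? 0
... | yes p0 = 0 , p0 , λ _ _ → z≤n
least P? zero    pm | no ¬p0 = contradiction pm ¬p0
least P? (suc m) pm | no ¬p0 with least (P? ∘ suc) m pm
... | j , pj , min = suc j , pj , λ where
  zero    p0 → contradiction p0 ¬p0
  (suc i) pi → s≤s (min i pi)

allSubset? : {P : Pred (Subset n) 0ℓ} → Decidable P → Dec (∀ S → P S)
allSubset? P? = map′
  (λ ¬∃ S → decidable-stable (P? S) (λ ¬p → ¬∃ (S , ¬p)))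
  (λ ∀p (S , ¬p) → ¬p (∀p S))
  (¬? (anySubset? (¬? ∘ P?)))

anyVec? : ∀ m {P : Pred (Vec (Subset n) m) 0ℓ} → Decidable P → Dec (∃ P)
anyVec? zero    P? = map′ ([] ,_) (λ { ([] , p) → p }) (P? [])
anyVec? (suc m) P? = map′
  (λ (S , Ss , p) → S ∷ Ss , p)
  (λ { (S ∷ Ss , p) → S , Ss , p })
  (anySubset? (λ S → anyVec? m (λ Ss → P? (S ∷ Ss))))

anyList? : ∀ m {P : Pred (List (Fin n)) 0ℓ} → Decidable P →
           (∀ xs → P xs → length xs ≤ m) → Dec (∃ P)
anyList? zero P? short = map′ ([] ,_)
  (λ { ([] , p) → p ; (x ∷ xs , p) → contradiction (short _ p) λ () })
  (P? [])
anyList? (suc m) {P} P? short = map′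
  (λ { (inj₁ p) → [] , p ; (inj₂ (x , xs , p)) → x ∷ xs , p })
  (λ { ([] , p) → inj₁ p ; (x ∷ xs , p) → inj₂ (x , xs , p) })
  (P? [] ⊎-dec
   any? (λ x → anyList? m (P? ∘ (x ∷_)) (λ xs p → s≤s⁻¹ (short _ p))))

-- Star R is decided by growing the set W of vertices known to be
-- reachable from u until it is closed under R.
module _ {R : Rel (Fin n) 0ℓ} (R? : B.Decidable R) (u : Fin n) where

  Closure : Set
  Closure = ∃[ W ] (u ∈ W × (∀ v → v ∈ W → Star R u v) ×
                    (∀ v w → v ∈ W → R v w → w ∈ W))

  grow : ∀ fuel W → n ≤ fuel + ∣ W ∣ → u ∈ W →
         (∀ v → v ∈ W → Star R u v) → Closure
  grow fuel W enough u∈W reach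
    with any? (λ v → any? (λ w → (v ∈? W) ×-dec ¬? (w ∈? W) ×-dec R? v w))
  ... | no ¬exit = W , u∈W , reach , λ v w v∈W r →
          decidable-stable (w ∈? W) (λ w∉W → ¬exit (v , w , v∈W , w∉W , r))
  ... | yes (v , w , v∈W , w∉W , r) = step fuel enough
    where
    W′ = W ∪ ⁅ w ⁆

    grows : ∣ W ∣ < ∣ W′ ∣
    grows = p⊂q⇒∣p∣<∣q∣ (p⊆p∪q ⁅ w ⁆ , w , q⊆p∪q W ⁅ w ⁆ (x∈⁅x⁆ w) , w∉W)

    reach′ : ∀ x → x ∈ W′ → Star R u x
    reach′ x x∈ with x∈p∪q⁻ W ⁅ w ⁆ x∈
    ... | inj₁ x∈W = reach x x∈W
    ... | inj₂ x∈w = subst (Star R u) (sym (x∈⁅y⁆⇒x≡y w x∈w)) (reach v v∈W ◅◅ r ◅ ε)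

    step : ∀ fuel → n ≤ fuel + ∣ W ∣ → Closure
    step zero       enough = contradiction (≤-trans (∣p∣≤n W′) enough) (<⇒≱ grows)
    step (suc fuel) enough = grow fuel W′
      (≤-trans enough (≤-trans (≤-reflexive (sym (+-suc fuel ∣ W ∣))) (+-monoʳ-≤ fuel grows)))
      (p⊆p∪q ⁅ w ⁆ u∈W) reach′

  star? : ∀ v → Dec (Star R u v)
  star? v with grow n ⁅ u ⁆ (≤-trans (≤-reflexive (sym (+-identityʳ n))) (+-monoʳ-≤ n z≤n))
                 (x∈⁅x⁆ u) (λ x x∈u → subst (Star R u) (sym (x∈⁅y⁆⇒x≡y u x∈u)) ε)
  ... | W , u∈W , reach , closed = map′ (reach v) (stay u∈W) (v ∈? W)
    where
    stay : ∀ {x y} → x ∈ W → Star R x y → y ∈ W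
    stay x∈W ε        = x∈W
    stay x∈W (r ◅ rs) = stay (closed _ _ x∈W r) rs

unique-short : (xs : List (Fin n)) → Unique xs → length xs ≤ n
unique-short xs u = injective⇒≤ {f = List.lookup xs} (injective xs u)
  where
  injective : ∀ xs → Unique xs → ∀ {i j} → List.lookup xs i ≡ List.lookup xs j → i ≡ j
  injective (x ∷ xs) _                   {zero}  {zero}  _  = refl
  injective (x ∷ xs) (x≢ AllPairs.∷ _)   {zero}  {suc j} eq =
    contradiction eq (All.lookup x≢ (∈-lookup j))
  injective (x ∷ xs) (x≢ AllPairs.∷ _)   {suc i} {zero}  eq =
    contradiction (sym eq) (All.lookup x≢ (∈-lookup i))
  injective (x ∷ xs) (_ AllPairs.∷ u)    {suc i} {suc j} eq = cong suc (injective xs u eq)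

module _ (G : Graph) where
  open Graph G using (Adj; adj?)

  inducedAdj? : ∀ {P} → Decidable P → B.Decidable (InducedAdj G P)
  inducedAdj? P? u v = P? u ×-dec P? v ×-dec adj? u v

  connected? : ∀ {P} → Decidable P → Dec (Connected G P)
  connected? P? = all? λ u → all? λ v →
    P? u →-dec P? v →-dec star? (inducedAdj? P?) u v

  acyclic? : ∀ {P} → Decidable P → Dec (Acyclic G P)
  acyclic? P? = ¬? (any? λ x → anyList? (order G)
    (λ xs → (2 ≤? length xs) ×-dec unique? Fin._≟_ (x ∷ xs) ×-dec
            linked? (inducedAdj? P?) (x ∷ xs ∷ʳ x))
    (λ xs (_ , u , _) → ≤-trans (m≤n+m _ 1) (unique-short (x ∷ xs) u)))

  isComponent? : ∀ S → Decidable (IsComponent G S)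
  isComponent? S C =
    (C ⊆? S) ×-dec nonempty? C ×-dec connected? (_∈? C) ×-dec
    allSubset? (λ D → (D ⊆? S) →-dec (C ⊆? D) →-dec
                      connected? (_∈? D) →-dec (D ⊆? C))

  isStrongForest? : ∀ k → Decidable (IsStrongForest G k)
  isStrongForest? k S =
    acyclic? (_∈? S) ×-dec
    allSubset? (λ C → isComponent? S C →-dec (k ≤? length (edges G C)))

  edgeIn? : ∀ u v → Decidable (EdgeIn G u v)
  edgeIn? u v S = inducedAdj? (_∈? S) u v

  isValid? : ∀ k u v → Dec (IsValid G k u v)
  isValid? k u v = anySubset? (λ S → isStrongForest? k S ×-dec edgeIn? u v S)

  hasCover? : ∀ k → Decidable (HasCover G k)
  hasCover? k m = anyVec? m λ Fs →
    all? (λ i → isStrongForest? k (lookup Fs i)) ×-dec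
    all? (λ u → all? λ v → isValid? k u v →-dec any? λ i → edgeIn? u v (lookup Fs i))

  ⊥-strong : ∀ k → IsStrongForest G k ⊥
  ⊥-strong k = noCycle , λ C (C⊆⊥ , (_ , x∈C) , _) → contradiction (C⊆⊥ x∈C) ∉⊥
    where
    noCycle : Acyclic G (_∈ ⊥)
    noCycle (x , y ∷ _ , _ , _ , (x∈⊥ , _) Linked.∷ _) = ∉⊥ x∈⊥

  -- One forest for every ordered pair of vertices.
  someCover : ∀ k → HasCover G k (order G * order G)
  someCover k = tabulate F , strong , covers
    where
    pick : ∀ u v → ∃[ S ] (IsStrongForest G k S × (IsValid G k u v → EdgeIn G u v S))
    pick u v with isValid? k u v
    ... | yes (S , s , e) = S , s , λ _ → e
    ... | no ¬valid       = ⊥ , ⊥-strong k , λ valid → contradiction valid ¬valid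

    F : Fin (order G * order G) → Subset (order G)
    F i = proj₁ (uncurry pick (remQuot (order G) i))

    strong : ∀ i → IsStrongForest G k (lookup (tabulate F) i)
    strong i = subst (IsStrongForest G k) (sym (lookup∘tabulate F i))
                 (proj₁ (proj₂ (uncurry pick (remQuot (order G) i))))

    covers : ∀ u v → IsValid G k u v → ∃[ i ] EdgeIn G u v (lookup (tabulate F) i)
    covers u v valid = combine u v ,
      subst (EdgeIn G u v) (sym (lookup∘tabulate F (combine u v)))
        (subst (λ uv → EdgeIn G u v (proj₁ (uncurry pick uv)))
          (sym (remQuot-combine u v)) (proj₂ (proj₂ (pick u v)) valid))

-- HasCover k m allows repeated and empty forests, which does not affect the
-- least m.
opaque
  leastCover : ∀ k G → ∃ (IsLeast (HasCover G k))
  leastCover k G = least (hasCover? G k) _ (someCover G k)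

strongInducedArboricity : ℕ → Graph → ℕ
strongInducedArboricity k G = proj₁ (leastCover k G)

strongInducedArboricity-isLeast : ∀ k G → IsLeast (HasCover G k) (strongInducedArboricity k G)
strongInducedArboricity-isLeast k G = proj₂ (leastCover k G)

{-# OPTIONS --safe #-}

-- Colour the vertices with t + 1 colours, injectively on every bag. Two
-- colour classes induce a forest, and deleting its isolated vertices gives
-- the bound on f₁. An edge uv is 2-valid iff some s is adjacent to exactly
-- one of u and v, so every 2-valid edge stays 2-valid in the subgraph of
-- three colour classes that contain u, v and s. It therefore suffices to
-- find three 2-strong forests for a graph of tree-width 2.
--
-- These come from a possibly improper 3-colouring in which any two classes
-- induce a forest and every 2-valid edge uv has a third vertex p adjacent to
-- u or v such that u, v, p are not rainbow. If an edge xz lies in no triangle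
-- and its contraction creates no new twins, then colour G/xz by induction and
-- give x and z the colour of the merged vertex: forests lift, and all edges
-- at x or z are served by xz. If there is no such edge, then the bag
-- colouring works: were xy a failing edge with z adjacent to x but not to y,
-- all neighbours of x and y would have the third colour, so xz is in no
-- triangle and its contraction must create twins u, v on a 4-cycle x u v z.
-- Then uv can be contracted if N(u) = {x, v}, and otherwise xu, since any
-- obstruction would be a two-coloured 4-cycle.

module Submission where

open import Defs hiding (Vertex; order)
open import Data.Bool using (true; false)
open import Data.Fin using (Fin; zero; suc)
import Data.Fin as Fin
open import Data.Fin.Properties using (any?; all?; injective⇒≤; ¬∀⟶∃¬; _≟_; <-cmp; <-asym)
open import Data.Fin.Subset as Subset using (Subset; ∣_∣; ⊥; ⁅_⁆; _∪_; inside; outside; _⊆_)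
open import Data.Fin.Subset.Properties
  using (s⊆s; out⊆; ∣p∣≤n; ∣⊥∣≡0; ∣⁅x⁆∣≡1; x∈p∪q⁻; x∈⁅x⁆; x∈⁅y⁆⇒x≡y; p⊆p∪q; q⊆p∪q)
  renaming (_∈?_ to _∈ˢ?_)
open import Data.List
  using (List; []; _∷_; _++_; _∷ʳ_; length; map; filter; allFin; concatMap; take; cartesianProduct; cartesianProductWith)
open import Data.List.Extrema.Nat using (max; xs≤max)
open import Data.List.Membership.Propositional using (_∈_; _∉_; find; lose)
open import Data.List.Membership.Propositional.Properties
  using (∈-map⁺; ∈-map⁻; ∈-filter⁺; ∈-filter⁻; ∈-++⁺ˡ; ∈-++⁺ʳ; ∈-++⁻; ∈-∃++; ∈-allFin; ∈-concatMap⁺; ∈-concatMap⁻;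
         ∈-cartesianProduct⁺; ∈-cartesianProductWith⁺; ∈-cartesianProductWith⁻)
open import Data.List.Membership.Setoid.Properties using (index-injective)
import Data.List.Membership.DecPropositional as DecMembership
open import Data.List.Properties using (length-map; length-++; length-take; length-tabulate; filter-notAll)
open import Data.List.Relation.Unary.All as All using (All; []; _∷_)
import Data.List.Relation.Unary.All.Properties as Allₚ
open import Data.List.Relation.Unary.AllPairs using ([]; _∷_)
open import Data.List.Relation.Unary.Any as Any using (Any; here; there)
import Data.List.Relation.Unary.Any.Properties as Anyₚ
open import Data.List.Relation.Unary.Linked using (Linked; [-]; _∷_)
open import Data.List.Relation.Unary.Unique.Propositional using (Unique)
import Data.List.Relation.Unary.Unique.Propositional.Properties as Uniqueₚ
open import Data.Nat using (ℕ; zero; suc; _+_; _*_; _≤_; _<_; z≤n; s≤s; s≤s⁻¹)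
open import Data.Nat.Combinatorics using (_C_; nCk+nC[k+1]≡[n+1]C[k+1]; k>n⇒nCk≡0; nCn≡1; nCk≡nC[n∸k])
open import Data.Nat.Properties
  using (≤-trans; ≤-reflexive; ≤-refl; _≤?_; ≰⇒>; <⇒≱; +-suc; +-comm; *-comm; +-monoʳ-≤; +-mono-≤; n≤1+n; m≤m+n;
         m≤n+m∸n; m⊓n≤m)
open import Data.Product using (∃-syntax; Σ-syntax; _×_; _,_; proj₁; proj₂)
open import Data.Sum using (_⊎_; inj₁; inj₂; swap)
open import Data.Vec using (fromList; tabulate; lookup; []; _∷_; here; there)
open import Data.Vec.Properties using (lookup∘tabulate; []=⇒lookup; lookup⇒[]=)
open import Function using (_∘_; id)
open import Level using (0ℓ)
open import Relation.Binary using (Rel; Symmetric; tri<; tri≈; tri>)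
import Relation.Binary as B
open import Relation.Binary.Construct.Closure.ReflexiveTransitive using (Star; ε; _◅_; _◅◅_) renaming (map to map⋆)
open import Relation.Binary.PropositionalEquality
  using (_≡_; _≢_; refl; sym; trans; cong; cong₂; subst; subst₂; setoid)
open import Relation.Nullary using (¬_; Dec; yes; no; does; contradiction)
open import Relation.Nullary.Decidable using (¬?; _×-dec_; _⊎-dec_; _→-dec_; decidable-stable; toWitness; dec-true)
open import Relation.Unary using (Pred; Decidable)

-- Leaves, colours and ordered bags

private
  variable
    n k : ℕ
    A B : Set

-- Acyclicity is used in the form that every nonempty list of vertices
-- contains one with at most one neighbour in it.
IsLeaf : Rel A 0ℓ → List A → A → Set
IsLeaf R S u = ∀ {p q} → p ∈ S → q ∈ S → R u p → R u q → p ≡ q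

HasLeaf : Rel A 0ℓ → List A → Set
HasLeaf R S = ∃[ u ] (u ∈ S × IsLeaf R S u)

NonRainbow : (A → B) → A → A → A → Set
NonRainbow c p q r = c p ≡ c q ⊎ c p ≡ c r ⊎ c q ≡ c r

nonRainbow-swap : ∀ (c : A → B) {p q r} → NonRainbow c p q r → NonRainbow c q p r
nonRainbow-swap _ (inj₁ e)        = inj₁ (sym e)
nonRainbow-swap _ (inj₂ (inj₁ e)) = inj₂ (inj₂ e)
nonRainbow-swap _ (inj₂ (inj₂ e)) = inj₂ (inj₁ e)

-- Forbidding rainbow triples says that at most two colours occur without naming them, so the
-- property transfers directly along maps of vertices.
TwoColoured : (A → B) → List A → Set
TwoColoured c S = ∀ {p q r} → p ∈ S → q ∈ S → r ∈ S → NonRainbow c p q r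

InjectiveOn : (A → B) → List A → Set
InjectiveOn c S = ∀ {u v} → u ∈ S → v ∈ S → c u ≡ c v → u ≡ v

Together : List (List A) → A → A → Set
Together Bs u v = Any (λ B → u ∈ B × v ∈ B) Bs

infix 4 _∈⋃_

_∈⋃_ : A → List (List A) → Set
v ∈⋃ Bs = Any (v ∈_) Bs

together⇒∈⋃ˡ : ∀ {Bs : List (List A)} {u v} → Together Bs u v → u ∈⋃ Bs
together⇒∈⋃ˡ = Any.map proj₁

together⇒∈⋃ʳ : ∀ {Bs : List (List A)} {u v} → Together Bs u v → v ∈⋃ Bs
together⇒∈⋃ʳ = Any.map proj₂

-- A tree decomposition, listed so that each bag is a leaf of the forest of
-- the bags from it to the end of the list; S is the bag it hangs on, or [] if
-- it starts a new tree.
data RunningIntersection {A : Set} : List (List A) → Set where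
  []  : RunningIntersection []
  add : ∀ {B Bs} S → S ∈ [] ∷ Bs → (∀ {v} → v ∈ B → v ∈⋃ Bs → v ∈ S) →
        RunningIntersection Bs → RunningIntersection (B ∷ Bs)

-- If the shared bag is the first one, separation puts both vertices into `S`, which is then
-- nonempty and hence a later bag.
together-tail : ∀ {B} {Bs : List (List A)} {u v} → RunningIntersection (B ∷ Bs) →
  Together (B ∷ Bs) u v → u ∈⋃ Bs → v ∈⋃ Bs → Together Bs u v
together-tail _ (there t) _ _ = t
together-tail (add S S∈ sep _) (here (u∈B , v∈B)) u∈ v∈ with S∈
... | there S∈Bs = lose S∈Bs (sep u∈B u∈ , sep v∈B v∈)
... | here refl  = contradiction (sep u∈B u∈) λ ()

∈⋃-map⁻ : ∀ (f : A → B) {Bs w} → w ∈⋃ map (map f) Bs → ∃[ v ] (v ∈⋃ Bs × w ≡ f v)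
∈⋃-map⁻ f w∈ with find (Anyₚ.map⁻ w∈)
... | _ , K∈ , w∈K with ∈-map⁻ f w∈K
... | v , v∈K , eq = v , lose K∈ v∈K , eq

-- Identified vertices share a bag, so the bags of the merged vertex form a union of subtrees that
-- meet, which is again a subtree.
runningIntersection-map : ∀ (f : A → B) {Bs} → RunningIntersection Bs →
  (∀ {u v} → u ∈⋃ Bs → v ∈⋃ Bs → f u ≡ f v → u ≡ v ⊎ Together Bs u v) →
  RunningIntersection (map (map f) Bs)
runningIntersection-map f [] _ = []
runningIntersection-map f {B ∷ Bs} ri@(add S S∈ sep ri′) glue =
  add (map f S) (∈-map⁺ (map f) S∈) sep′ (runningIntersection-map f ri′ glue′)
  where
  glue′ : ∀ {u v} → u ∈⋃ Bs → v ∈⋃ Bs → f u ≡ f v → u ≡ v ⊎ Together Bs u v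
  glue′ u∈ v∈ eq with glue (there u∈) (there v∈) eq
  ... | inj₁ u≡v = inj₁ u≡v
  ... | inj₂ t   = inj₂ (together-tail ri t u∈ v∈)

  sep′ : ∀ {w} → w ∈ map f B → w ∈⋃ map (map f) Bs → w ∈ map f S
  sep′ w∈B w∈Bs with ∈-map⁻ f w∈B | ∈⋃-map⁻ f w∈Bs
  ... | u , u∈ , refl | v , v∈ , eq with glue (here u∈) (there v∈) eq
  ...   | inj₁ refl = ∈-map⁺ f (sep u∈ v∈)
  -- Since `v` lies both in this bag and in a later one, it represents `w` in `S`.
  ...   | inj₂ (here (_ , v∈B)) = subst (_∈ map f S) (sym eq) (∈-map⁺ f (sep v∈B v∈))
  ...   | inj₂ (there t) = ∈-map⁺ f (sep u∈ (together⇒∈⋃ˡ t))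

-- Only membership matters, so `f` is specified by membership alone; `restrictBag` also reorders
-- bags and drops repetitions.
runningIntersection-restrict : (P : Pred A 0ℓ) (f : List A → List A) → ∀ {Bs} →
  All (λ B → ∀ {v} → (v ∈ f B → v ∈ B × P v) × (v ∈ B → P v → v ∈ f B)) Bs →
  RunningIntersection Bs → RunningIntersection (map f Bs)
runningIntersection-restrict P f [] [] = []
runningIntersection-restrict P f {B ∷ Bs} (fB ∷ fBs) (add S S∈ sep ri) =
  hang S∈ (runningIntersection-restrict P f fBs ri)
  where
  shrink : ∀ {v} → v ∈⋃ map f Bs → v ∈⋃ Bs
  shrink v∈ with find (Anyₚ.map⁻ v∈)
  ... | K , K∈ , v∈fK = lose K∈ (proj₁ (proj₁ (All.lookup fBs K∈) v∈fK))

  hang : S ∈ [] ∷ Bs → RunningIntersection (map f Bs) → RunningIntersection (f B ∷ map f Bs)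
  hang (here refl) = add [] (here refl) λ v∈ v∈⋃ → sep (proj₁ (proj₁ fB v∈)) (shrink v∈⋃)
  hang (there S∈Bs) = add (f S) (there (∈-map⁺ f S∈Bs)) λ v∈ v∈⋃ →
    proj₂ (All.lookup fBs S∈Bs) (sep (proj₁ (proj₁ fB v∈)) (shrink v∈⋃)) (proj₂ (proj₁ fB v∈))

module _ {n : ℕ} where
  open DecMembership (_≟_ {n}) public using (_∈?_)

_∈⋃?_ : (v : Fin n) → ∀ Bs → Dec (v ∈⋃ Bs)
v ∈⋃? Bs = Any.any? (v ∈?_) Bs

module _ {c : Fin n → Fin k} {R : Rel (Fin n) 0ℓ} (irrefl : ∀ {v} → ¬ R v v) where

  -- Bags are dropped until one contains a vertex `u` of `S` that occurs in no later bag. All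
  -- neighbours of `u` in `S` then lie in this bag, where they have different colours, none of them
  -- that of `u`; only one colour is left for them.
  twoColoured⇒hasLeaf : ∀ {Bs S v} → RunningIntersection Bs → All (InjectiveOn c) Bs →
    v ∈ S → TwoColoured c S →
    (∀ {p q} → p ∈ S → q ∈ S → R p q → Together Bs p q) → HasLeaf R S
  twoColoured⇒hasLeaf {[]} {v = v} _ _ v∈ _ cover =
    v , v∈ , λ p∈ _ r _ → contradiction (cover v∈ p∈ r) λ ()
  twoColoured⇒hasLeaf {B ∷ Bs} {S} ri@(add _ _ _ ri′) (inj ∷ injs) v∈ two cover
    with any? (λ u → (u ∈? S) ×-dec (u ∈? B) ×-dec ¬? (u ∈⋃? Bs))
  ... | no ¬new = twoColoured⇒hasLeaf ri′ injs v∈ two λ {p} {q} p∈ q∈ r →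
          let t = cover p∈ q∈ r in together-tail ri t (old p p∈ (together⇒∈⋃ˡ t)) (old q q∈ (together⇒∈⋃ʳ t))
    where
    old : ∀ u → u ∈ S → u ∈⋃ B ∷ Bs → u ∈⋃ Bs
    old u u∈S (there u∈) = u∈
    old u u∈S (here u∈B) = decidable-stable (u ∈⋃? Bs) λ u∉ → ¬new (u , u∈S , u∈B , u∉)
  ... | yes (u , u∈S , u∈B , u∉) = u , u∈S , leaf
    where
    inB : ∀ {p} → Together (B ∷ Bs) u p → p ∈ B
    inB (here (_ , p∈)) = p∈
    inB (there t)       = contradiction (together⇒∈⋃ˡ t) u∉

    apart : ∀ {p} → p ∈ S → R u p → c u ≢ c p
    apart p∈ r eq with inj u∈B (inB (cover u∈S p∈ r)) eq
    ... | refl = irrefl r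

    leaf : IsLeaf R S u
    leaf p∈ q∈ rp rq with two u∈S p∈ q∈
    ... | inj₁ eq        = contradiction eq (apart p∈ rp)
    ... | inj₂ (inj₁ eq) = contradiction eq (apart q∈ rq)
    ... | inj₂ (inj₂ eq) = inj (inB (cover u∈S p∈ rp)) (inB (cover u∈S q∈ rq)) eq

-- Colourings that are injective on every bag

unusedColour : (xs : List (Fin k)) → length xs < k → ∃[ a ] a ∉ xs
-- If all colours occurred, mapping each to its position would inject `Fin k` into a shorter list.
unusedColour {k} xs short = ¬∀⟶∃¬ k (_∈ xs) (_∈? xs) λ all∈ →
  <⇒≱ short (injective⇒≤ (index-injective (setoid _) (all∈ _) (all∈ _)))

filter-complement-length : ∀ {P : Pred A 0ℓ} (P? : Decidable P) xs →
  length (filter (¬? ∘ P?) xs) + length (filter P? xs) ≡ length xs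
filter-complement-length P? [] = refl
filter-complement-length P? (x ∷ xs) with P? x
... | yes _ = trans (+-suc _ _) (cong suc (filter-complement-length P? xs))
... | no  _ = cong suc (filter-complement-length P? xs)

update : (Fin n → B) → Fin n → B → Fin n → B
update c x a v with v ≟ x
... | yes _ = a
... | no  _ = c v

-- Greedy colouring: each vertex of `xs` in turn avoids the colours already used on the list.
recolour : ∀ (c : Fin n → Fin k) xs ds → InjectiveOn c ds → length xs + length ds ≤ k →
  ∃[ c′ ] (InjectiveOn c′ (xs ++ ds) × (∀ {v} → v ∉ xs → c′ v ≡ c v))
recolour c [] ds inj _ = c , inj , λ _ → refl
recolour c (x ∷ xs) ds inj short with recolour c xs ds inj (≤-trans (n≤1+n _) short)
... | c₁ , injective₁ , agree with x ∈? (xs ++ ds)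
-- A repeated vertex already has its colour and must keep it.
... | yes x∈ = c₁ , (λ u∈ v∈ → injective₁ (drop u∈) (drop v∈)) , λ v∉ → agree (v∉ ∘ there)
  where
  drop : ∀ {v} → v ∈ x ∷ xs ++ ds → v ∈ xs ++ ds
  drop (here refl) = x∈
  drop (there v∈)  = v∈
... | no x∉ with unusedColour (map c₁ (xs ++ ds))
                (≤-trans (≤-reflexive (cong suc (trans (length-map c₁ (xs ++ ds)) (length-++ xs)))) short)
... | a , a∉ = update c₁ x a , inj′ , agree′
  where
  c′ = update c₁ x a

  agree′ : ∀ {v} → v ∉ x ∷ xs → c′ v ≡ c v
  agree′ {v} v∉ with v ≟ x
  ... | yes v≡x = contradiction (here v≡x) v∉
  ... | no  _   = agree (v∉ ∘ there)

  other : ∀ {v} → v ∈ x ∷ xs ++ ds → v ≢ x → v ∈ xs ++ ds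
  other (here v≡x) v≢x = contradiction v≡x v≢x
  other (there v∈) _   = v∈

  inj′ : InjectiveOn c′ (x ∷ xs ++ ds)
  inj′ {u} {v} u∈ v∈ eq with u ≟ x | v ≟ x
  ... | yes refl | yes refl = refl
  ... | yes refl | no v≢x   = contradiction (subst (_∈ _) (sym eq) (∈-map⁺ c₁ (other v∈ v≢x))) a∉
  ... | no u≢x   | yes refl = contradiction (subst (_∈ _) eq (∈-map⁺ c₁ (other u∈ u≢x))) a∉
  ... | no u≢x   | no v≢x   = injective₁ (other u∈ u≢x) (other v∈ v≢x) eq

-- The bags are coloured from the last to the first. The old vertices of a bag lie together in the
-- later bag `S`, so their colours already differ and only the new vertices need colours.
bagColouring : ∀ {Bs : List (List (Fin n))} → RunningIntersection Bs →
  All (λ B → length B ≤ suc k) Bs → ∃[ c ] All (InjectiveOn {B = Fin (suc k)} c) Bs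
bagColouring [] [] = (λ _ → zero) , []
bagColouring {Bs = B ∷ Bs} (add S S∈ sep ri) (short ∷ shorts)
  with bagColouring ri shorts
... | c , injs with recolour c (filter (¬? ∘ (_∈⋃? Bs)) B) (filter (_∈⋃? Bs) B) (oldInjective S∈)
                     (≤-trans (≤-reflexive (filter-complement-length (_∈⋃? Bs) B)) short)
  where
  oldInjective : S ∈ [] ∷ Bs → InjectiveOn c (filter (_∈⋃? Bs) B)
  oldInjective S∈ {u} {v} u∈ v∈ with ∈-filter⁻ (_∈⋃? Bs) {xs = B} u∈ | ∈-filter⁻ (_∈⋃? Bs) {xs = B} v∈ | S∈
  ... | u∈B , u∈⋃ | _ | here refl = contradiction (sep u∈B u∈⋃) λ ()
  ... | u∈B , u∈⋃ | v∈B , v∈⋃ | there S∈Bs = All.lookup injs S∈Bs (sep u∈B u∈⋃) (sep v∈B v∈⋃)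
... | c′ , inj′ , agree = c′ , injB ∷ All.tabulate injBs
  where
  split : ∀ {v} → v ∈ B → v ∈ filter (¬? ∘ (_∈⋃? Bs)) B ++ filter (_∈⋃? Bs) B
  split {v} v∈ with v ∈⋃? Bs
  ... | yes old = ∈-++⁺ʳ _ (∈-filter⁺ (_∈⋃? Bs) v∈ old)
  ... | no new  = ∈-++⁺ˡ (∈-filter⁺ (¬? ∘ (_∈⋃? Bs)) v∈ new)

  injB : InjectiveOn c′ B
  injB u∈ v∈ = inj′ (split u∈) (split v∈)

  old : ∀ {K v} → K ∈ Bs → v ∈ K → c′ v ≡ c v
  old K∈ v∈ = agree λ v∈new → proj₂ (∈-filter⁻ (¬? ∘ (_∈⋃? Bs)) {xs = B} v∈new) (lose K∈ v∈)

  injBs : ∀ {K} → K ∈ Bs → InjectiveOn c′ K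
  injBs K∈ u∈ v∈ eq =
    All.lookup injs K∈ u∈ v∈ (trans (sym (old K∈ u∈)) (trans eq (old K∈ v∈)))

-- Colourings of graphs of tree-width 2

-- Here `k` bounds the bag size and is thus the width plus one. An isolated vertex may lie in no
-- bag, as happens to `z` after a contraction.
record BagDecomposition (k : ℕ) (G : Graph) : Set where
  field
    bags    : List (List (Graph.Vertex G))
    running : RunningIntersection bags
    short   : All (λ B → length B ≤ k) bags
    cover   : ∀ {u v} → Graph.Adj G u v → Together bags u v

module _ (G : Graph) where
  open Graph G

  -- For adjacent `u` and `v`, this says that `s` is in the closed neighbourhood of `u` but not in
  -- that of `v`.
  Distinguishes : Vertex → Vertex → Vertex → Set
  Distinguishes s u v = s ≢ v × Adj u s × ¬ Adj v s

  -- With `p` the edge becomes a path of two edges that misses a colour, so the forest on the other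
  -- two colours contains it.
  Extends : (Vertex → Fin 3) → Vertex → Vertex → Set
  Extends c u v = ∃[ p ] (p ≢ u × p ≢ v × (Adj u p ⊎ Adj v p) × NonRainbow c u v p)

  TriangleFree : Vertex → Vertex → Set
  TriangleFree x z = ∀ w → Adj x w → ¬ Adj z w

  -- The witness avoids `x` and `z`, so it still distinguishes vertices other than `x` and `z` after
  -- their edge is contracted.
  Distinguished : Vertex → Vertex → Vertex → Vertex → Set
  Distinguished x z u v =
    ∃[ s ] (s ≢ x × s ≢ z × (Distinguishes s u v ⊎ Distinguishes s v u))

  -- On a 4-cycle u x z v, contracting xz must not turn u and v into twins.
  Safe : Vertex → Vertex → Set
  Safe x z = ∀ u v → Adj u x → Adj v z → Adj u v → u ≢ z → v ≢ x → Distinguished x z u v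

  Contractible : Vertex → Vertex → Set
  Contractible x z = Adj x z × TriangleFree x z × Safe x z

  distinguishes? : ∀ s u v → Dec (Distinguishes s u v)
  distinguishes? s u v = ¬? (s ≟ v) ×-dec adj? u s ×-dec ¬? (adj? v s)

  distinguished? : ∀ x z u v → Dec (Distinguished x z u v)
  distinguished? x z u v = any? λ s → ¬? (s ≟ x) ×-dec ¬? (s ≟ z) ×-dec
    (distinguishes? s u v ⊎-dec distinguishes? s v u)

  contractible? : ∀ x z → Dec (Contractible x z)
  contractible? x z = adj? x z ×-dec
    all? (λ w → adj? x w →-dec ¬? (adj? z w)) ×-dec
    all? λ u → all? λ v → adj? u x →-dec adj? v z →-dec adj? u v →-dec
      ¬? (u ≟ z) →-dec ¬? (v ≟ x) →-dec distinguished? x z u v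

  extends? : ∀ c u v → Dec (Extends c u v)
  extends? c u v = any? λ p → ¬? (p ≟ u) ×-dec ¬? (p ≟ v) ×-dec (adj? u p ⊎-dec adj? v p) ×-dec
    ((c u ≟ c v) ⊎-dec (c u ≟ c p) ⊎-dec (c v ≟ c p))

  record GoodColouring : Set where
    field
      colour   : Vertex → Fin 3
      leaf     : ∀ {S v} → v ∈ S → TwoColoured colour S → HasLeaf Adj S
      extended : ∀ {u v s} → Adj u v → Distinguishes s u v → Extends colour u v

-- Contraction of an edge

module Contraction (G : Graph) {x z : Graph.Vertex G} (xz : Graph.Adj G x z) where
  open Graph G

  x≢z : x ≢ z
  x≢z refl = adj-irrefl xz

  π : Vertex → Vertex
  π v with v ≟ z
  ... | yes _ = x
  ... | no  _ = v

  π-fix : ∀ {v} → v ≢ z → π v ≡ v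
  π-fix {v} v≢z with v ≟ z
  ... | yes v≡z = contradiction v≡z v≢z
  ... | no  _   = refl

  πz≡x : π z ≡ x
  πz≡x with z ≟ z
  ... | yes _  = refl
  ... | no z≢z = contradiction refl z≢z

  π≢z : ∀ v → π v ≢ z
  π≢z v with v ≟ z
  ... | yes _  = x≢z
  ... | no v≢z = v≢z

  data Fibre (u v : Vertex) : Set where
    same : u ≡ v → Fibre u v
    x~z  : u ≡ x → v ≡ z → Fibre u v
    z~x  : u ≡ z → v ≡ x → Fibre u v

  fibre : ∀ u v → π u ≡ π v → Fibre u v
  fibre u v eq with u ≟ z | v ≟ z
  ... | yes refl | yes refl = same refl
  ... | yes refl | no _     = z~x refl (sym eq)
  ... | no _     | yes refl = x~z eq refl
  ... | no _     | no _     = same eq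

  merged : ∀ u v → π u ≡ π v → u ≢ v → π u ≡ x
  merged u v eq u≢v with fibre u v eq
  ... | same u≡v      = contradiction u≡v u≢v
  ... | x~z refl refl = π-fix x≢z
  ... | z~x refl refl = πz≡x

  pair : ∀ u v w → π u ≡ π v → π w ≡ π v → u ≢ v → w ≢ v → u ≡ w
  pair u v w eu ew u≢v w≢v with fibre u v eu | fibre w v ew
  ... | same e     | _          = contradiction e u≢v
  ... | _          | same e     = contradiction e w≢v
  ... | x~z u≡x _  | x~z w≡x _ = trans u≡x (sym w≡x)
  ... | z~x u≡z _  | z~x w≡z _ = trans u≡z (sym w≡z)
  ... | x~z _ refl | z~x _ z≡x = contradiction (sym z≡x) x≢z
  ... | z~x _ refl | x~z _ x≡z = contradiction x≡z x≢z

  loopless : ∀ {u v} → Adj u v → u ≢ v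
  loopless a refl = adj-irrefl a

  away : ∀ {u v} → v ≢ x → π u ≡ v → u ≡ v
  away {u} v≢x eq with u ≟ z
  ... | yes _ = contradiction (sym eq) v≢x
  ... | no _  = eq

  -- The vertex z is kept, but isolated.
  contract : Graph
  contract = record
    { order      = order
    ; Adj        = λ p q → p ≢ q × ∃[ u ] ∃[ v ] (π u ≡ p × π v ≡ q × Adj u v)
    ; adj?       = λ p q → ¬? (p ≟ q) ×-dec any? λ u → any? λ v →
                     (π u ≟ p) ×-dec (π v ≟ q) ×-dec adj? u v
    ; adj-sym    = λ (p≢q , u , v , eu , ev , a) → p≢q ∘ sym , v , u , ev , eu , adj-sym a
    ; adj-irrefl = λ (p≢p , _) → p≢p refl
    }

  open Graph contract using () renaming (Adj to Adj′; adj-sym to adj-sym′)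

  project : ∀ {u v} → π u ≢ π v → Adj u v → Adj′ (π u) (π v)
  project ne a = ne , _ , _ , refl , refl , a

  lift : ∀ {u v} → u ≢ z → v ≢ z → Adj u v → Adj′ u v
  lift {u} {v} u≢z v≢z a =
    (λ { refl → adj-irrefl a }) , u , v , π-fix u≢z , π-fix v≢z , a

  lower : ∀ {u v} → u ≢ x → v ≢ x → Adj′ u v → Adj u v
  lower {u} {v} u≢x v≢x (_ , p , q , πp , πq , a) with away {p} {u} u≢x πp | away {q} {v} v≢x πq
  ... | refl | refl = a

  bagDecomposition : ∀ {k} → BagDecomposition k G → BagDecomposition k contract
  bagDecomposition {k} D = record
    { bags    = map (map π) bags
    ; running = runningIntersection-map π running λ {u} {v} _ _ → glue ∘ fibre u v
    ; short   = Allₚ.map⁺ (All.map (λ {B} → ≤-trans (≤-reflexive (length-map π B))) short)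
    ; cover   = λ { (_ , u , v , refl , refl , a) →
                    Anyₚ.map⁺ (Any.map (λ (u∈ , v∈) → ∈-map⁺ π u∈ , ∈-map⁺ π v∈) (cover a)) }
    }
    where
    open BagDecomposition D
    glue : ∀ {u v} → Fibre u v → u ≡ v ⊎ Together bags u v
    glue (same eq)       = inj₁ eq
    glue (x~z refl refl) = inj₂ (cover xz)
    glue (z~x refl refl) = inj₂ (cover (adj-sym xz))

  module _ (triangleFree : TriangleFree G x z) where

    -- Only `x` and `z` are identified, and in the absence of triangles they have no common
    -- neighbour.
    injectiveNear : ∀ {v} p q → Adj v p → Adj v q → π p ≡ π q → p ≡ q
    injectiveNear p q a b eq with fibre p q eq
    ... | same p≡q      = p≡q
    ... | x~z refl refl = contradiction (adj-sym b) (triangleFree _ (adj-sym a))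
    ... | z~x refl refl = contradiction (adj-sym a) (triangleFree _ (adj-sym b))

    onlyTouches : ∀ {S} v → IsLeaf Adj′ (map π S) (π v) →
      (∀ {p} → p ∈ S → Adj v p → π p ≢ π v) → IsLeaf Adj S v
    onlyTouches v leaf unmerged {p} {q} p∈ q∈ a b = injectiveNear p q a b
      (leaf (∈-map⁺ π p∈) (∈-map⁺ π q∈) (project (unmerged p∈ a ∘ sym) a) (project (unmerged q∈ b ∘ sym) b))

    -- If both x and z lie in S, then the merged vertex has at most one
    -- neighbour, which by triangle-freeness is adjacent to only one of them.
    liftLeaf : ∀ {S} → HasLeaf Adj′ (map π S) → HasLeaf Adj S
    liftLeaf {S} (_ , πv∈ , leaf) with ∈-map⁻ π πv∈
    ... | v , v∈ , refl with any? (λ w → (w ∈? S) ×-dec adj? v w ×-dec (π w ≟ π v))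
    ...   | no ¬w = v , v∈ , onlyTouches v leaf λ {p} p∈ a eq → ¬w (p , p∈ , a , eq)
    ...   | yes (w , w∈ , vw , eq) with any? (λ p → (p ∈? S) ×-dec adj? v p ×-dec ¬? (p ≟ w))
    ...     | no ¬p = v , v∈ , λ p∈ q∈ a b → trans (only p∈ a) (sym (only q∈ b))
      where
      only : ∀ {p} → p ∈ S → Adj v p → p ≡ w
      only {p} p∈ a = decidable-stable (p ≟ w) λ p≢w → ¬p (p , p∈ , a , p≢w)
    -- As `v` has a second neighbour `p`, the leaf is `w`. A neighbour `q` of `w` other than `v`
    -- would have the same image as `p`; hence it would be `p` itself, and `v w p` a triangle.
    ...     | yes (p , p∈ , vp , p≢w) = w , w∈ , λ q∈ r∈ a b → trans (only q∈ a) (sym (only r∈ b))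
      where
      noTriangle : ∀ {q} → Adj v q → ¬ Adj w q
      noTriangle a b with fibre w v eq
      ... | same refl     = adj-irrefl vw
      ... | x~z refl refl = triangleFree _ b a
      ... | z~x refl refl = triangleFree _ a b

      only : ∀ {q} → q ∈ S → Adj w q → q ≡ v
      only {q} q∈ wq = decidable-stable (q ≟ v) λ q≢v →
        let πp≢πv = λ e → p≢w (pair p v w e eq (loopless vp ∘ sym) (loopless vw ∘ sym))
            πq≢πv = λ e → loopless wq (sym (pair q v w e eq q≢v (loopless vw ∘ sym)))
            πq≡πp = leaf (∈-map⁺ π q∈) (∈-map⁺ π p∈)
                      (subst (λ y → Adj′ y (π q)) eq (project (λ e → πq≢πv (trans (sym e) eq)) wq))
                      (project (πp≢πv ∘ sym) vp)
        in πq≢πv (trans (merged q p πq≡πp λ { refl → noTriangle vp wq })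
                        (sym (merged v w (sym eq) (loopless vw))))

    module _ (safe : Safe G x z) (good : GoodColouring contract) where
      open GoodColouring good renaming (colour to c; leaf to leaf′; extended to extended′)

      -- Here `u` and `y` are the ends of the contracted edge. They share a colour, so `y` extends
      -- every other edge at `u`.
      nearFibre : ∀ {u v y} → π u ≡ π y → Adj u y → y ≢ v → Extends G (c ∘ π) u v
      nearFibre eq a y≢v = _ , loopless a ∘ sym , y≢v , inj₁ a , inj₂ (inj₁ (cong c eq))

      extends-sym : ∀ {H c u v} → Extends H c u v → Extends H c v u
      extends-sym {c = d} (p , p≢u , p≢v , near , nr) = p , p≢v , p≢u , swap near , nonRainbow-swap d nr

      module Away {u v} (u≢x : u ≢ x) (u≢z : u ≢ z) (v≢x : v ≢ x) (v≢z : v ≢ z) where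

        liftDistinguishes : ∀ {s} → s ≢ x → s ≢ z → Distinguishes G s u v → Distinguishes contract s u v
        liftDistinguishes s≢x s≢z (s≢v , us , ¬vs) = s≢v , lift u≢z s≢z us , ¬vs ∘ lower v≢x s≢x

        hub : ∀ {y} → π y ≡ x → Adj u y → ¬ Adj v x → ¬ Adj v z → Distinguishes contract x u v
        hub {y} πy≡x uy ¬vx ¬vz =
          v≢x ∘ sym , (u≢x , u , y , π-fix u≢z , πy≡x , uy) , ¬vx′
          where
          ¬vx′ : ¬ Adj′ v x
          ¬vx′ (_ , a , b , πa , πb , ab) with away {a} v≢x πa | fibre b x (trans πb (sym (π-fix x≢z)))
          ... | refl | same refl  = ¬vx ab
          ... | refl | x~z refl _ = ¬vx ab
          ... | refl | z~x refl _ = ¬vz ab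

        lowerExtends : Extends contract c u v → Extends G (c ∘ π) u v
        lowerExtends (p , p≢u , p≢v , near , nr) with preimage near
          where
          preimage : Adj′ u p ⊎ Adj′ v p → ∃[ q ] (π q ≡ p × (Adj u q ⊎ Adj v q))
          preimage (inj₁ (_ , a , q , πa , πq , aq)) with away {a} u≢x πa
          ... | refl = q , πq , inj₁ aq
          preimage (inj₂ (_ , a , q , πa , πq , aq)) with away {a} v≢x πa
          ... | refl = q , πq , inj₂ aq
        ... | q , refl , near′ = q , (λ { refl → p≢u (π-fix u≢z) }) , (λ { refl → p≢v (π-fix v≢z) }) , near′ ,
          subst₂ (λ a b → a ≡ b ⊎ a ≡ c (π q) ⊎ b ≡ c (π q))
            (cong c (sym (π-fix u≢z))) (cong c (sym (π-fix v≢z))) nr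

      extended-away : ∀ {u v s} → u ≢ x → u ≢ z → v ≢ x → v ≢ z →
        Adj u v → Distinguishes G s u v → Extends G (c ∘ π) u v
      extended-away {u} {v} {s} u≢x u≢z v≢x v≢z uv d@(s≢v , us , ¬vs) = lowerExtends (extends s d)
        where
        open Away u≢x u≢z v≢x v≢z
        module Swapped = Away v≢x v≢z u≢x u≢z

        uv′ : Adj′ u v
        uv′ = lift u≢z v≢z uv

        fromDistinguished : Distinguished G x z u v → Extends contract c u v
        fromDistinguished (s , s≢x , s≢z , inj₁ d) = extended′ uv′ (liftDistinguishes s≢x s≢z d)
        fromDistinguished (s , s≢x , s≢z , inj₂ d) =
          extends-sym {contract} (extended′ (adj-sym′ uv′) (Swapped.liftDistinguishes s≢x s≢z d))

        distinguished-sym : Distinguished G x z v u → Distinguished G x z u v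
        distinguished-sym (s , s≢x , s≢z , d) = s , s≢x , s≢z , swap d

        extends : ∀ s → Distinguishes G s u v → Extends contract c u v
        extends s d@(s≢v , us , ¬vs) with s ≟ x | s ≟ z
        ... | no s≢x | no s≢z = extended′ uv′ (liftDistinguishes s≢x s≢z d)
        -- The witness is an end of the contracted edge. If `v` is adjacent to the other end, a
        -- 4-cycle arises and safety gives another witness; if not, the merged vertex serves.
        ... | yes refl | _ with adj? v z
        ...   | yes vz = fromDistinguished (safe u v us vz uv u≢z v≢x)
        ...   | no ¬vz = extended′ uv′ (hub (π-fix x≢z) us ¬vs ¬vz)
        extends s d@(s≢v , us , ¬vs) | no _ | yes refl with adj? v x
        ...   | yes vx = fromDistinguished (distinguished-sym (safe v u vx us (adj-sym uv) v≢z u≢x))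
        ...   | no ¬vx = extended′ uv′ (hub πz≡x us ¬vx ¬vs)

      πx≡πz : π x ≡ π z
      πx≡πz = trans (π-fix x≢z) (sym πz≡x)

      lowerColouring : GoodColouring G
      lowerColouring = record
        { colour = c ∘ π
        ; leaf = λ v∈ two → liftLeaf (leaf′ (∈-map⁺ π v∈) (twoColoured-map two))
        ; extended = extended
        }
        where
        twoColoured-map : ∀ {S} → TwoColoured (c ∘ π) S → TwoColoured c (map π S)
        twoColoured-map two p∈ q∈ r∈ with ∈-map⁻ π p∈ | ∈-map⁻ π q∈ | ∈-map⁻ π r∈
        ... | _ , p∈′ , refl | _ , q∈′ , refl | _ , r∈′ , refl = two p∈′ q∈′ r∈′

        extended : ∀ {u v s} → Adj u v → Distinguishes G s u v → Extends G (c ∘ π) u v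
        extended {u} {v} {s} uv d@(s≢v , us , _) with π u ≟ π v
        -- This is the contracted edge itself: its ends share a colour, so any third vertex next to
        -- it will do.
        ... | yes eq   = s , loopless us ∘ sym , s≢v , inj₁ us , inj₁ (cong c eq)
        ... | no πu≢πv = split (u ≟ x) (u ≟ z) (v ≟ x) (v ≟ z)
          where
          split : Dec (u ≡ x) → Dec (u ≡ z) → Dec (v ≡ x) → Dec (v ≡ z) → Extends G (c ∘ π) u v
          split (yes refl) _ _ _ = nearFibre πx≡πz xz λ { refl → πu≢πv πx≡πz }
          split _ (yes refl) _ _ = nearFibre (sym πx≡πz) (adj-sym xz) λ { refl → πu≢πv (sym πx≡πz) }
          split _ (no u≢z) (yes refl) _ = extends-sym {G} (nearFibre πx≡πz xz (u≢z ∘ sym))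
          split (no u≢x) _ _ (yes refl) = extends-sym {G} (nearFibre (sym πx≡πz) (adj-sym xz) (u≢x ∘ sym))
          split (no u≢x) (no u≢z) (no v≢x) (no v≢z) = extended-away u≢x u≢z v≢x v≢z uv d

-- Graphs without a contractible edge

thirdColour : ∀ {a b p q : Fin 3} → a ≢ b → p ≢ a → p ≢ b → q ≢ a → q ≢ b → p ≡ q
thirdColour {a} {b} {p} {q} = toWitness {a? = all? λ a → all? λ b → all? λ p → all? λ q →
  ¬? (a ≟ b) →-dec ¬? (p ≟ a) →-dec ¬? (p ≟ b) →-dec ¬? (q ≟ a) →-dec ¬? (q ≟ b) →-dec (p ≟ q)} _ a b p q

twoOf⇒twoColoured : ∀ {A B : Set} {c : A → B} {a b S} →
  (∀ {p} → p ∈ S → c p ≡ a ⊎ c p ≡ b) → TwoColoured c S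
twoOf⇒twoColoured two p∈ q∈ r∈ with two p∈ | two q∈ | two r∈
... | inj₁ e | inj₁ f | _      = inj₁ (trans e (sym f))
... | inj₂ e | inj₂ f | _      = inj₁ (trans e (sym f))
... | inj₁ e | inj₂ _ | inj₁ g = inj₂ (inj₁ (trans e (sym g)))
... | inj₂ e | inj₁ _ | inj₂ g = inj₂ (inj₁ (trans e (sym g)))
... | inj₁ _ | inj₂ f | inj₂ g = inj₂ (inj₂ (trans f (sym g)))
... | inj₂ _ | inj₁ f | inj₁ g = inj₂ (inj₂ (trans f (sym g)))

module Uncontractible (G : Graph) (D : BagDecomposition 3 G)
  (stuck : ∀ x z → ¬ Contractible G x z) where
  open Graph G
  open BagDecomposition D

  c : Vertex → Fin 3
  c = proj₁ (bagColouring running short)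

  leaf : ∀ {S v} → v ∈ S → TwoColoured c S → HasLeaf Adj S
  leaf v∈ two = twoColoured⇒hasLeaf adj-irrefl running (proj₂ (bagColouring running short))
    v∈ two λ _ _ → cover

  proper : ∀ {u v} → Adj u v → c u ≢ c v
  proper a eq with find (cover a)
  ... | _ , B∈ , u∈ , v∈ with All.lookup (proj₂ (bagColouring running short)) B∈ u∈ v∈ eq
  ...   | refl = adj-irrefl a

  -- A two-coloured set has a leaf, but every vertex of a 4-cycle has two neighbours on it.
  noTwoColouredSquare : ∀ {p q r s} → Adj p q → Adj q r → Adj r s → Adj s p →
    p ≢ r → q ≢ s → c p ≡ c r → c q ≢ c s
  noTwoColouredSquare {p} {q} {r} {s} pq qr rs sp p≢r q≢s cp≡cr cq≡cs
    with leaf {p ∷ q ∷ r ∷ s ∷ []} (here refl) (twoOf⇒twoColoured {a = c p} {c q} λ where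
      (here refl)                         → inj₁ refl
      (there (here refl))                 → inj₂ refl
      (there (there (here refl)))         → inj₁ (sym cp≡cr)
      (there (there (there (here refl)))) → inj₂ (sym cq≡cs))
  ... | _ , here refl , l = q≢s (l (there (here refl)) (there (there (there (here refl)))) pq (adj-sym sp))
  ... | _ , there (here refl) , l = p≢r (l (here refl) (there (there (here refl))) (adj-sym pq) qr)
  ... | _ , there (there (here refl)) , l =
    q≢s (l (there (here refl)) (there (there (there (here refl)))) (adj-sym qr) rs)
  ... | _ , there (there (there (here refl))) , l =
    p≢r (l (here refl) (there (there (here refl))) sp (adj-sym rs))

  module Bad {x y} (xy : Adj x y) (bad : ¬ Extends G c x y) where

    Third : Vertex → Set
    Third p = c p ≢ c x × c p ≢ c y

    -- A neighbour sharing a colour with `x` or `y` would extend the failing edge.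
    third : ∀ {p} → Adj x p ⊎ Adj y p → p ≢ x → p ≢ y → Third p
    third near p≢x p≢y =
      (λ e → bad (_ , p≢x , p≢y , near , inj₂ (inj₁ (sym e)))) ,
      (λ e → bad (_ , p≢x , p≢y , near , inj₂ (inj₂ (sym e))))

    third-same : ∀ {p q} → Third p → Third q → c p ≡ c q
    third-same (a , b) (a′ , b′) = thirdColour (proper xy) a b a′ b′

    third-apart : ∀ {p q} → Third p → Third q → ¬ Adj p q
    third-apart tp tq a = proper a (third-same tp tq)

    Private : Vertex → Set
    Private z = Adj x z × ¬ Adj y z × z ≢ y

    private-third : ∀ {z} → Private z → Third z
    private-third (xz , _ , z≢y) = third (inj₁ xz) (λ { refl → adj-irrefl xz }) z≢y

    -- A common neighbour of `x` and `z` would have the third colour, which its neighbour `z` has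
    -- too.
    private-triangleFree : ∀ {z} → Private z → TriangleFree G x z
    private-triangleFree pz@(xz , ¬yz , z≢y) w xw zw = third-apart (private-third pz)
      (third (inj₁ xw) (λ { refl → adj-irrefl xw }) λ { refl → ¬yz (adj-sym zw) }) zw

    -- Why the edge xz cannot be contracted.
    record Obstruction (z u v : Vertex) : Set where
      field
        ux  : Adj u x
        vz  : Adj v z
        uv  : Adj u v
        u≢z : u ≢ z
        v≢x : v ≢ x
        uninvolved : ¬ Distinguished G x z u v
        pu  : Private u
        cv  : c v ≡ c y

      -- Vertices outside the 4-cycle do not distinguish `u` from `v`.
      forward : ∀ {s} → s ≢ x → s ≢ z → s ≢ v → Adj u s → Adj v s
      forward {s} s≢x s≢z s≢v us = decidable-stable (adj? v s) λ ¬vs →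
        uninvolved (s , s≢x , s≢z , inj₁ (s≢v , us , ¬vs))

      backward : ∀ {s} → s ≢ x → s ≢ z → s ≢ u → Adj v s → Adj u s
      backward {s} s≢x s≢z s≢u vs = decidable-stable (adj? u s) λ ¬us →
        uninvolved (s , s≢x , s≢z , inj₂ (s≢u , vs , ¬us))

    y≢x : y ≢ x
    y≢x refl = adj-irrefl xy

    -- The edge `xz` lies in no triangle, so only safety can keep it from being contracted. The
    -- double negation is enough because every use ends in a contradiction.
    obstructed : ∀ {z} → Private z → ¬ (∀ u v → ¬ Obstruction z u v)
    obstructed {z} pz@(xz , ¬yz , z≢y) none = stuck x z (xz , private-triangleFree pz , safe)
      where
      tz = private-third pz

      safe : Safe G x z
      safe u v ux vz uv u≢z v≢x = decidable-stable (distinguished? G x z u v) λ un → none u v (record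
        { ux = ux ; vz = vz ; uv = uv ; u≢z = u≢z ; v≢x = v≢x ; uninvolved = un
        ; pu = adj-sym ux , ¬yu un , u≢y
        -- The colour of `v` is not the third one, which `u` has, nor that of `x`, as `x u v z`
        -- would be a two-coloured 4-cycle.
        ; cv = thirdColour (proj₁ tu ∘ sym)
                 (λ e → noTwoColouredSquare (adj-sym ux) uv vz (adj-sym xz) (v≢x ∘ sym) u≢z
                          (sym e) (third-same tu tz))
                 (proper uv ∘ sym) (proper xy ∘ sym) (proj₂ tu ∘ sym)
        })
        where
        u≢y : u ≢ y
        u≢y refl = third-apart (third (inj₂ uv) v≢x λ { refl → adj-irrefl uv }) tz vz

        tu : Third u
        tu = third (inj₁ (adj-sym ux)) (λ { refl → adj-irrefl ux }) u≢y

        ¬yu : ¬ Distinguished G x z u v → ¬ Adj y u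
        -- As `y` does not distinguish `u` from `v`, it would be adjacent to `v` as well, and `v`
        -- would have the third colour like `u`.
        ¬yu un yu = third-apart tu (third (inj₂ yv) v≢x λ { refl → adj-irrefl yv }) uv
          where
          yv : Adj y v
          yv = adj-sym (decidable-stable (adj? v y) λ ¬vy →
            un (y , y≢x , z≢y ∘ sym , inj₁ ((λ { refl → ¬yz vz }) , adj-sym yu , ¬vy)))

    noPrivate : ∀ {z} → ¬ Private z
    noPrivate {z} pz@(xz , ¬yz , z≢y) = obstructed pz λ u v o → resolve u v o
      where
      tz = private-third pz

      resolve : ∀ u v → ¬ Obstruction z u v
      resolve u v o with any? (λ s → adj? u s ×-dec ¬? (s ≟ x) ×-dec ¬? (s ≟ v))
      -- The only neighbours of `u` are `x` and `v`, so the edge `uv` turns out to be contractible.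
      ... | no ¬s = stuck u v (uv , triangleFree , safe)
        where
        open Obstruction o

        ¬xv : ¬ Adj x v
        ¬xv xv = private-triangleFree pz v xv (adj-sym vz)

        degree2 : ∀ s → Adj u s → s ≢ x → s ≡ v
        degree2 s us s≢x = decidable-stable (s ≟ v) λ s≢v → ¬s (s , us , s≢x , s≢v)

        triangleFree : TriangleFree G u v
        triangleFree w uw vw with w ≟ x
        ... | yes refl = ¬xv (adj-sym vw)
        ... | no w≢x with degree2 w uw w≢x
        ...   | refl = adj-irrefl vw

        safe : Safe G u v
        safe p q pu′ qv pq p≢v q≢u with p ≟ x
        ... | no p≢x = contradiction (degree2 p (adj-sym pu′) p≢x) p≢v
        ... | yes refl with q ≟ z
        -- On the 4-cycle `x u v z` itself, `y` is adjacent to `x` but not to `z`.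
        ...   | yes refl = y , (λ { refl → proj₂ (proj₂ pu) refl }) , (λ { refl → ¬yz vz }) ,
                           inj₁ (z≢y ∘ sym , xy , ¬yz ∘ adj-sym)
        -- Any other neighbour `q` of `v` would be a further neighbour of `u`.
        ...   | no q≢z = contradiction (degree2 q (backward q≢x q≢z q≢u (adj-sym qv)) q≢x)
                           λ { refl → adj-irrefl qv }
          where
          q≢x : q ≢ x
          q≢x refl = adj-irrefl pq
      -- Now `xu` is examined. Its obstruction has to consist of `z` and `v`, which makes `z`
      -- adjacent to `s` and `x u s z` a two-coloured 4-cycle.
      ... | yes (s , us , s≢x , s≢v) = obstructed pu λ u′ v′ → clash
        where
        open Obstruction o
        tu = private-third pu

        s≢z : s ≢ z
        s≢z refl = third-apart tu tz us

        vs : Adj v s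
        vs = forward s≢x s≢z s≢v us

        cx≡cs : c x ≡ c s
        -- `s` is adjacent to `u`, which has the third colour, and to `v`, which has the colour of
        -- `y`.
        cx≡cs = thirdColour (proj₂ tu ∘ sym) (proper xy) (proj₁ tu ∘ sym)
          (λ e → proper vs (trans cv (sym e))) (proper us ∘ sym)

        clash : ∀ {u′ v′} → ¬ Obstruction u u′ v′
        clash {u′} {v′} o′ = noTwoColouredSquare (adj-sym ux) us (adj-sym zs) (adj-sym xz)
          (s≢x ∘ sym) u≢z cx≡cs (third-same tu tz)
          where
          module O = Obstruction o′

          v′≡v : v′ ≡ v
          -- Another `v′` would, as a neighbour of `u`, be adjacent to `v`, although both have the
          -- colour of `y`.
          v′≡v = decidable-stable (v′ ≟ v) λ v′≢v →
            proper (forward O.v≢x (λ { refl → proj₂ tz O.cv }) v′≢v (adj-sym O.vz))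
              (trans cv (sym O.cv))

          u′≡z : u′ ≡ z
          u′≡z = decidable-stable (u′ ≟ z) λ u′≢z → third-apart tu (private-third O.pu)
            (backward (λ { refl → adj-irrefl O.ux }) u′≢z O.u≢z
              (subst (λ w → Adj w u′) v′≡v (adj-sym O.uv)))

          zs : Adj z s
          zs = subst (λ w → Adj w s) u′≡z (O.backward s≢x (λ { refl → adj-irrefl us })
            (λ s≡u′ → s≢z (trans s≡u′ u′≡z)) (subst (λ w → Adj w s) (sym v′≡v) vs))

  goodColouring : GoodColouring G
  goodColouring = record
    { colour   = c
    ; leaf     = leaf
    ; extended = λ {u} {v} uv (s≢v , us , ¬vs) → decidable-stable (extends? G c u v) λ bad →
        Bad.noPrivate uv bad (us , ¬vs , s≢v)
    }

-- Existence of good colourings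

opaque
  -- Contraction keeps `z` as an isolated vertex and does not lower the order. The induction
  -- therefore runs on a list `V` of the vertices that may carry edges, from which `z` is removed.
  goodColouring : ∀ m (G : Graph) → BagDecomposition 3 G → (V : List (Graph.Vertex G)) →
    (∀ {u v} → Graph.Adj G u v → u ∈ V) → length V ≤ m → GoodColouring G
  goodColouring m G D V touched short with any? (λ x → any? (contractible? G x))
  ... | no stuck = Uncontractible.goodColouring G D λ x z con → stuck (x , z , con)
  goodColouring zero G D [] touched _ | yes (_ , _ , xz , _) = contradiction (touched xz) λ ()
  goodColouring (suc m) G D V touched short | yes (x , z , xz , triangleFree , safe) =
    lowerColouring triangleFree safe (goodColouring m contract (bagDecomposition D) (filter (λ v → ¬? (v ≟ z)) V)
      (λ { (_ , u , _ , refl , _ , uv) → ∈-filter⁺ (λ v → ¬? (v ≟ z)) (π-touched u uv) (π≢z u) })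
      (s≤s⁻¹ (≤-trans (filter-notAll (λ v → ¬? (v ≟ z)) V
        (lose (touched (Graph.adj-sym G xz)) λ z≢z → z≢z refl)) short)))
    where
    open Contraction G xz

    π-touched : ∀ u {v} → Graph.Adj G u v → π u ∈ V
    π-touched u uv with u ≟ z
    ... | yes _ = touched xz
    ... | no _  = touched uv

-- Acyclic graphs and tree decompositions

unique-prefix : ∀ xs {p : A} {ys} → Unique (xs ++ p ∷ ys) → Unique (p ∷ xs)
unique-prefix [] _ = [] ∷ []
unique-prefix (x ∷ xs) (x∉ ∷ u) with unique-prefix xs u
... | p∉ ∷ u′ = ((λ p≡x → All.lookup x∉ (Anyₚ.++⁺ʳ xs (here refl)) (sym p≡x)) ∷ p∉) ∷ (Allₚ.++⁻ˡ xs x∉ ∷ u′)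

linked-prefix : ∀ {R : Rel A 0ℓ} x xs {p ys} → Linked R (x ∷ xs ++ p ∷ ys) → Linked R (x ∷ xs ∷ʳ p)
linked-prefix x []       (r ∷ _) = r ∷ [-]
linked-prefix x (y ∷ xs) (r ∷ l) = r ∷ linked-prefix y xs l

module _ {R : Rel (Fin n) 0ℓ} (R? : B.Decidable R) (R-sym : Symmetric R) (irrefl : ∀ {v} → ¬ R v v)
  (acyclic : ¬ (∃[ x ] ∃[ xs ] IsCycle R x xs)) where

  private
    previous : Fin n → List (Fin n) → Fin n
    -- At the start of the walk `v` stands in for its missing predecessor; being no neighbour of
    -- itself, it excludes nothing.
    previous v []      = v
    previous _ (w ∷ _) = w

    -- The walk is stored with its latest vertex first. Since `p` is not the predecessor of `v`, the
    -- closed part has at least three vertices.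
    close : ∀ v ps {p} → Unique (v ∷ ps) → Linked R (v ∷ ps) → p ∈ ps → R p v → p ≢ previous v ps →
            ∃[ x ] ∃[ xs ] IsCycle R x xs
    close v ps uniq linked p∈ pv p≢prev with ∈-∃++ p∈
    ... | []     , _ , refl = contradiction refl p≢prev
    ... | a ∷ as , _ , refl = _ , v ∷ a ∷ as , s≤s (s≤s z≤n) ,
            unique-prefix (v ∷ a ∷ as) uniq , pv ∷ linked-prefix v (a ∷ as) linked

  -- Without a leaf, a walk that never turns straight back can always be continued; within `n` steps
  -- it meets itself and closes a cycle.
  acyclic⇒hasLeaf : ∀ {S v} → v ∈ S → HasLeaf R S
  acyclic⇒hasLeaf {S} {v} v∈
    with any? (λ u → (u ∈? S) ×-dec all? λ p → all? λ q →
           (p ∈? S) →-dec (q ∈? S) →-dec R? u p →-dec R? u q →-dec (p ≟ q))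
  ... | yes (u , u∈ , leaf) = u , u∈ , λ {p} {q} → leaf p q
  ... | no ¬leaf = contradiction (walk n v [] v∈ ([] ∷ []) [-] (m≤m+n n 0)) acyclic
    where
    branch : ∀ {u} w → u ∈ S → ∃[ p ] (p ∈ S × R u p × p ≢ w)
    branch {u} w u∈ with any? (λ p → (p ∈? S) ×-dec R? u p ×-dec ¬? (p ≟ w))
    ... | yes b = b
    ... | no ¬b = contradiction (u , u∈ , λ p q p∈ q∈ a b → trans (only p∈ a) (sym (only q∈ b))) ¬leaf
      where
      only : ∀ {p} → p ∈ S → R u p → p ≡ w
      only {p} p∈ a = decidable-stable (p ≟ w) λ p≢w → ¬b (p , p∈ , a , p≢w)

    walk : ∀ fuel v ps → v ∈ S → Unique (v ∷ ps) → Linked R (v ∷ ps) → n ≤ fuel + length ps →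
           ∃[ x ] ∃[ xs ] IsCycle R x xs
    walk zero v ps _ uniq _ enough = contradiction enough (<⇒≱ (unique-short (v ∷ ps) uniq))
    walk (suc fuel) v ps v∈ uniq linked enough with branch (previous v ps) v∈
    ... | p , p∈ , vp , p≢prev with p ∈? ps
    ...   | yes p∈ps = close v ps uniq linked p∈ps (R-sym vp) p≢prev
    ...   | no p∉ps  = walk fuel p (v ∷ ps) p∈
            (((λ { refl → irrefl vp }) ∷ Allₚ.¬Any⇒All¬ ps p∉ps) ∷ uniq)
            (R-sym vp ∷ linked) (≤-trans enough (≤-reflexive (sym (+-suc fuel (length ps)))))

module _ {R : Rel A 0ℓ} (R-sym : Symmetric R) where

  private
    -- The two neighbours are the predecessor and the successor. The disjunction keeps them apart
    -- when only one vertex lies between `a` and `b`.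
    interior : ∀ a ys b {u} → Linked R (a ∷ ys ∷ʳ b) → Unique (a ∷ ys) → b ∉ ys →
      2 ≤ length ys ⊎ a ≢ b → u ∈ ys →
      ∃[ p ] ∃[ q ] (p ≢ q × p ∈ a ∷ ys ∷ʳ b × q ∈ a ∷ ys ∷ʳ b × R u p × R u q)
    interior a (y ∷ []) b (r ∷ r′ ∷ _) _ _ (inj₂ a≢b) (here refl) =
      a , b , a≢b , here refl , there (there (here refl)) , R-sym r , r′
    interior a (y ∷ []) b _ _ _ (inj₁ (s≤s ())) _
    interior a (y ∷ z ∷ ys) b (r ∷ r′ ∷ _) ((_ ∷ a≢z ∷ _) ∷ _) _ _ (here refl) =
      a , z , a≢z , here refl , there (there (here refl)) , R-sym r , r′
    interior a (y ∷ ys@(_ ∷ _)) b (r ∷ l) (_ ∷ u) b∉ _ (there u∈)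
      with interior y ys b l u (b∉ ∘ there) (inj₂ λ { refl → b∉ (here refl) }) u∈
    ... | p , q , p≢q , p∈ , q∈ , up , uq = p , q , p≢q , there p∈ , there q∈ , up , uq

    last : ∀ y ys b → Linked R (y ∷ ys ∷ʳ b) → 1 ≤ length ys → ∃[ l ] (l ∈ ys × R l b)
    last y (z ∷ [])         b (_ ∷ r ∷ _) _ = z , here refl , r
    last y (z ∷ ys@(_ ∷ _)) b (_ ∷ l) _ with last z ys b l (s≤s z≤n)
    ... | w , w∈ , wb = w , there w∈ , wb

  -- Every vertex of a cycle has two different neighbours on it; for the starting vertex these are
  -- the first and the last of the others.
  hasLeaf⇒acyclic : (∀ {S v} → v ∈ S → HasLeaf R S) → ¬ (∃[ x ] ∃[ xs ] IsCycle R x xs)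
  hasLeaf⇒acyclic hasLeaf (x , xs , long , uniq@(x∉ ∷ _) , linked) with hasLeaf {x ∷ xs} (here refl)
  ... | u , there u∈ , leaf
    with interior x xs x linked uniq (λ x∈ → All.lookup x∉ x∈ refl) (inj₁ long) u∈
  ...   | p , q , p≢q , p∈ , q∈ , up , uq = p≢q (leaf (unwrap p∈) (unwrap q∈) up uq)
    where
    unwrap : ∀ {p} → p ∈ x ∷ xs ∷ʳ x → p ∈ x ∷ xs
    unwrap (here e) = here e
    unwrap (there p∈) with ∈-++⁻ xs p∈
    ... | inj₁ p∈xs     = there p∈xs
    ... | inj₂ (here e) = here e
  hasLeaf⇒acyclic hasLeaf (x , y ∷ ys , long , _ ∷ (y∉ ∷ _) , xy ∷ linked) | _ , here refl , leaf
    with last y ys x linked (s≤s⁻¹ long)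
  ... | l , l∈ , lx = All.lookup y∉ l∈ (leaf (there (here refl)) (there (there l∈)) xy (R-sym lx))

-- From tree decompositions to ordered bags

elements : Subset n → List (Fin n)
elements []          = []
elements (true  ∷ S) = zero ∷ map suc (elements S)
elements (false ∷ S) = map suc (elements S)

length-elements : (S : Subset n) → length (elements S) ≡ ∣ S ∣
length-elements []          = refl
length-elements (true  ∷ S) = cong suc (trans (length-map suc (elements S)) (length-elements S))
length-elements (false ∷ S) = trans (length-map suc (elements S)) (length-elements S)

∈-elements⁺ : ∀ {S : Subset n} {v} → v Subset.∈ S → v ∈ elements S
∈-elements⁺ {S = true  ∷ S} here       = here refl
∈-elements⁺ {S = true  ∷ S} (there v∈) = there (∈-map⁺ suc (∈-elements⁺ v∈))
∈-elements⁺ {S = false ∷ S} (there v∈) = ∈-map⁺ suc (∈-elements⁺ v∈)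

∈-elements⁻ : ∀ (S : Subset n) {v} → v ∈ elements S → v Subset.∈ S
∈-elements⁻ (true ∷ S) (here refl) = here
∈-elements⁻ (true ∷ S) (there v∈) with ∈-map⁻ suc v∈
... | _ , w∈ , refl = there (∈-elements⁻ S w∈)
∈-elements⁻ (false ∷ S) v∈ with ∈-map⁻ suc v∈
... | _ , w∈ , refl = there (∈-elements⁻ S w∈)

module FromTree {G : Graph} (D : TreeDecomposition G) where
  open TreeDecomposition D
  open Graph tree using (adj?; adj-sym; adj-irrefl) renaming (Adj to _∼_; Vertex to Node)

  private
    -- Only the target of a step is tested, as walks start at nodes already known to qualify.
    Link : List Node → Graph.Vertex G → Rel Node 0ℓ
    Link S v i j = i ∼ j × j ∈ S × v Subset.∈ bag j

    Subtrees : List Node → Set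
    Subtrees S = ∀ {v i j} → i ∈ S → j ∈ S → v Subset.∈ bag i → v Subset.∈ bag j → Star (Link S v) i j

    leafNode : ∀ {S i} → i ∈ S → HasLeaf _∼_ S
    leafNode i∈ with acyclic⇒hasLeaf (inducedAdj? tree (λ _ → yes _)) (λ (_ , _ , a) → _ , _ , adj-sym a)
                       (adj-irrefl ∘ proj₂ ∘ proj₂) (proj₂ (proj₂ isTree)) i∈
    ... | u , u∈ , leaf = u , u∈ , λ p∈ q∈ a b → leaf p∈ q∈ (_ , _ , a) (_ , _ , b)

    without : Node → List Node → List Node
    without j = filter (λ i → ¬? (i ≟ j))

    -- A walk through the leaf j enters and leaves it through the same neighbour.
    subtrees-without : ∀ {S j} → IsLeaf _∼_ S j → Subtrees S → Subtrees (without j S)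
    subtrees-without {S} {j} leaf sub i∈ k∈ vi vk
      with ∈-filter⁻ (λ i → ¬? (i ≟ j)) {xs = S} i∈ | ∈-filter⁻ (λ i → ¬? (i ≟ j)) {xs = S} k∈
    ... | i∈S , i≢j | k∈S , k≢j = shortcut i∈S (sub i∈S k∈S vi vk)
      where
      shortcut : ∀ {i} → i ∈ S → Star (Link S _) i _ → Star (Link (without j S) _) i _
      shortcut i∈ ε = ε
      shortcut i∈ (_◅_ {j = a} (ia , a∈ , va) rs) with a ≟ j
      ... | no a≢j = (ia , ∈-filter⁺ (λ i → ¬? (i ≟ j)) a∈ a≢j , va) ◅ shortcut a∈ rs
      shortcut i∈ (_ ◅ ε) | yes refl = contradiction refl k≢j
      shortcut i∈ ((ij , _) ◅ (jb , b∈ , _) ◅ rs) | yes refl with leaf b∈ i∈ jb (adj-sym ij)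
      ... | refl = shortcut i∈ rs

    bagOf : Node → List (Graph.Vertex G)
    bagOf i = elements (bag i)

    -- A leaf `j` of `S` is listed first and hangs on its only neighbour, or on the empty bag if it
    -- has none. A vertex shared with a later bag gives a walk from `j` whose first step goes to
    -- that neighbour.
    order : ∀ m S → length S ≤ m → Subtrees S →
      ∃[ is ] (RunningIntersection (map bagOf is) × (∀ {i} → i ∈ S → i ∈ is) × (∀ {i} → i ∈ is → i ∈ S))
    order _ [] _ _ = [] , [] , (λ ()) , λ ()
    order (suc m) S@(_ ∷ _) short sub with leafNode {S} (here refl)
    ... | j , j∈ , leaf with order m (without j S)
                  (s≤s⁻¹ (≤-trans (filter-notAll (λ i → ¬? (i ≟ j)) S (lose j∈ λ j≢j → j≢j refl)) short))
                  (subtrees-without leaf sub)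
    ...   | is , ri , complete , sound = j ∷ is , attach (any? λ p → (p ∈? S) ×-dec adj? j p) , complete′ , sound′
      where
      inS : ∀ {i} → i ∈ is → i ∈ S × i ≢ j
      inS i∈ = ∈-filter⁻ (λ i → ¬? (i ≟ j)) {xs = S} (sound i∈)

      inIs : ∀ {i} → i ∈ S → i ≢ j → i ∈ is
      inIs i∈ i≢j = complete (∈-filter⁺ (λ i → ¬? (i ≟ j)) i∈ i≢j)

      complete′ : ∀ {i} → i ∈ S → i ∈ j ∷ is
      complete′ {i} i∈ with i ≟ j
      ... | yes i≡j = here i≡j
      ... | no i≢j  = there (inIs i∈ i≢j)

      sound′ : ∀ {i} → i ∈ j ∷ is → i ∈ S
      sound′ (here refl) = j∈
      sound′ (there i∈)  = proj₁ (inS i∈)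

      firstStep : ∀ {v} → v ∈ bagOf j → v ∈⋃ map bagOf is → ∃[ p ] (p ∈ S × j ∼ p × v Subset.∈ bag p)
      firstStep v∈ v∈⋃ with find (Anyₚ.map⁻ v∈⋃)
      ... | i , i∈ , v∈i with inS i∈
      ...   | i∈S , i≢j with sub j∈ i∈S (∈-elements⁻ (bag j) v∈) (∈-elements⁻ (bag i) v∈i)
      ...     | ε                  = contradiction refl i≢j
      ...     | (jp , p∈ , vp) ◅ _ = _ , p∈ , jp , vp

      attach : Dec (∃[ p ] (p ∈ S × j ∼ p)) → RunningIntersection (map bagOf (j ∷ is))
      attach (yes (p , p∈ , jp)) =
        add (bagOf p) (there (∈-map⁺ bagOf (inIs p∈ λ { refl → adj-irrefl jp }))) sep ri
        where
        sep : ∀ {v} → v ∈ bagOf j → v ∈⋃ map bagOf is → v ∈ bagOf p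
        sep v∈ v∈⋃ with firstStep v∈ v∈⋃
        ... | q , q∈ , jq , vq with leaf q∈ p∈ jq jp
        ...   | refl = ∈-elements⁺ vq
      attach (no ¬p) = add [] (here refl) (λ v∈ v∈⋃ → let p , p∈ , jp , _ = firstStep v∈ v∈⋃ in
        contradiction (p , p∈ , jp) ¬p) ri

  bagDecomposition : BagDecomposition (suc width) G
  bagDecomposition with order _ (allFin _) ≤-refl (λ {v} {i} {j} _ _ vi vj →
      map⋆ (λ (_ , v∈ , a) → a , ∈-allFin _ , v∈) (bags-connected v i j vi vj))
  ... | is , ri , complete , _ = record
    { bags    = map bagOf is
    ; running = ri
    -- Even with truncated subtraction, the largest bag size is at most `suc width`.
    ; short   = Allₚ.map⁺ (All.tabulate λ {i} _ → ≤-trans (≤-reflexive (length-elements (bag i)))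
        (≤-trans (All.lookup (xs≤max 0 sizes) (∈-map⁺ (∣_∣ ∘ bag) (∈-allFin i))) (m≤n+m∸n (max 0 sizes) 1)))
    ; cover   = λ {u} {v} uv → let i , u∈ , v∈ = edge-covered u v uv in
        lose (∈-map⁺ bagOf (complete (∈-allFin i))) (∈-elements⁺ u∈ , ∈-elements⁺ v∈)
    }
    where
    sizes = map (∣_∣ ∘ bag) (allFin (Graph.order tree))

-- Subsets of given size

include : ∀ {k} → Σ[ T ∈ Subset n ] ∣ T ∣ ≡ k → Σ[ T ∈ Subset (suc n) ] ∣ T ∣ ≡ suc k
include (T , eq) = inside ∷ T , cong suc eq

exclude : ∀ {k} → Σ[ T ∈ Subset n ] ∣ T ∣ ≡ k → Σ[ T ∈ Subset (suc n) ] ∣ T ∣ ≡ k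
exclude (T , eq) = outside ∷ T , eq

choose : ∀ n k → List (Σ[ T ∈ Subset n ] ∣ T ∣ ≡ k)
choose n       zero    = (⊥ , ∣⊥∣≡0 n) ∷ []
choose zero    (suc k) = []
choose (suc n) (suc k) = map include (choose n k) ++ map exclude (choose n (suc k))

length-choose : ∀ n k → length (choose n k) ≡ n C k
length-choose n       zero    = sym (trans (nCk≡nC[n∸k] {k = 0} {n = n} z≤n) (nCn≡1 n))
length-choose zero    (suc k) = sym (k>n⇒nCk≡0 {0} {suc k} (s≤s z≤n))
length-choose (suc n) (suc k) = trans (length-++ (map include (choose n k)))
  (trans (cong₂ _+_ (trans (length-map include (choose n k)) (length-choose n k))
                    (trans (length-map exclude (choose n (suc k))) (length-choose n (suc k))))
         (nCk+nC[k+1]≡[n+1]C[k+1] n k))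

∣S∣≤0⇒⊆ : ∀ {S T : Subset n} → ∣ S ∣ ≤ 0 → S ⊆ T
∣S∣≤0⇒⊆ {S = S} small v∈ with elements S | length-elements S | ∈-elements⁺ v∈
... | _ ∷ _ | eq | _ = contradiction (≤-trans (≤-reflexive eq) small) λ ()

-- `S` may be smaller than `k` because the colours that it collects may coincide.
choose-covers : ∀ {n k} (S : Subset n) → ∣ S ∣ ≤ k → k ≤ n → Any (λ T → S ⊆ proj₁ T) (choose n k)
choose-covers {n}     {zero}  S small _ = here (∣S∣≤0⇒⊆ small)
choose-covers {suc n} {suc k} (true ∷ S) small k≤n = Anyₚ.++⁺ˡ (Anyₚ.map⁺
  (Any.map (λ {T} (S⊆T : S ⊆ proj₁ T) {x} → s⊆s S⊆T {x}) (choose-covers S (s≤s⁻¹ small) (s≤s⁻¹ k≤n))))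
choose-covers {suc n} {suc k} (false ∷ S) small k≤n with suc k ≤? n
... | yes k<n = Anyₚ.++⁺ʳ _ (Anyₚ.map⁺
  (Any.map (λ {T} (S⊆T : S ⊆ proj₁ T) {x} → s⊆s S⊆T {x}) (choose-covers S small k<n)))
-- Here `k` equals `n`, so the chosen set must be the full one and includes the head although `S`
-- omits it.
... | no k≮n  = Anyₚ.++⁺ˡ (Anyₚ.map⁺
  (Any.map (λ {T} (S⊆T : S ⊆ proj₁ T) {x} → out⊆ S⊆T {x})
    (choose-covers S (≤-trans (∣p∣≤n S) (s≤s⁻¹ (≰⇒> k≮n))) (s≤s⁻¹ k≤n))))

∣p∪q∣≤∣p∣+∣q∣ : ∀ (p q : Subset n) → ∣ p ∪ q ∣ ≤ ∣ p ∣ + ∣ q ∣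
∣p∪q∣≤∣p∣+∣q∣ []          []          = z≤n
∣p∪q∣≤∣p∣+∣q∣ (true  ∷ p) (true  ∷ q) = s≤s (≤-trans (∣p∪q∣≤∣p∣+∣q∣ p q) (+-monoʳ-≤ ∣ p ∣ (n≤1+n _)))
∣p∪q∣≤∣p∣+∣q∣ (true  ∷ p) (false ∷ q) = s≤s (∣p∪q∣≤∣p∣+∣q∣ p q)
∣p∪q∣≤∣p∣+∣q∣ (false ∷ p) (true  ∷ q) = ≤-trans (s≤s (∣p∪q∣≤∣p∣+∣q∣ p q)) (≤-reflexive (sym (+-suc ∣ p ∣ ∣ q ∣)))
∣p∪q∣≤∣p∣+∣q∣ (false ∷ p) (false ∷ q) = ∣p∪q∣≤∣p∣+∣q∣ p q

opaque
  fromPred : {P : Pred (Fin n) 0ℓ} → Decidable P → Subset n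
  fromPred P? = tabulate (does ∘ P?)

  ∈-fromPred⁺ : {P : Pred (Fin n) 0ℓ} (P? : Decidable P) → ∀ {v} → P v → v Subset.∈ fromPred P?
  ∈-fromPred⁺ P? {v} p = lookup⇒[]= v _ (trans (lookup∘tabulate (does ∘ P?) v) (dec-true (P? v) p))

  ∈-fromPred⁻ : {P : Pred (Fin n) 0ℓ} (P? : Decidable P) → ∀ {v} → v Subset.∈ fromPred P? → P v
  ∈-fromPred⁻ P? {v} v∈ with P? v | trans (sym (lookup∘tabulate (does ∘ P?) v)) ([]=⇒lookup v∈)
  ... | yes p | _ = p

two-members : ∀ {xs : List A} {x y} → x ∈ xs → y ∈ xs → x ≢ y → 2 ≤ length xs
two-members (here refl)          (here refl)          x≢y = contradiction refl x≢y
two-members {xs = _ ∷ _ ∷ _} (here _)  (there _) _ = s≤s (s≤s z≤n)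
two-members {xs = _ ∷ _ ∷ _} (there _) _         _ = s≤s (s≤s z≤n)

-- Strong forests

module _ (G : Graph) where
  open Graph G

  hasCover : ∀ k Fs → All (IsStrongForest G k) Fs →
    (∀ u v → IsValid G k u v → Any (EdgeIn G u v) Fs) → HasCover G k (length Fs)
  hasCover k Fs strong covers = fromList Fs , lookupAll strong , λ u v valid → lookupAny (covers u v valid)
    where
    lookupAll : ∀ {P : Pred (Subset order) 0ℓ} {Fs} → All P Fs → ∀ i → P (lookup (fromList Fs) i)
    lookupAll (p ∷ _)  zero    = p
    lookupAll (_ ∷ ps) (suc i) = lookupAll ps i

    lookupAny : ∀ {P : Pred (Subset order) 0ℓ} {Fs} → Any P Fs → ∃[ i ] P (lookup (fromList Fs) i)
    lookupAny (here p)  = zero , p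
    lookupAny (there p) = let i , q = lookupAny p in suc i , q

  arboricity≤ : ∀ {k m} Fs → length Fs ≡ m → All (IsStrongForest G k) Fs →
    (∀ u v → IsValid G k u v → Any (EdgeIn G u v) Fs) → strongInducedArboricity k G ≤ m
  arboricity≤ {k} Fs refl strong covers =
    proj₂ (strongInducedArboricity-isLeast k G) _ (hasCover k Fs strong covers)

  module _ {S : Subset order} where

    -- A vertex of the list outside `S` has no neighbours in the induced subgraph and is itself a
    -- leaf.
    inducedForest : (∀ {T v} → v ∈ T → (∀ {p} → p ∈ T → p Subset.∈ S) → HasLeaf Adj T) → IsInducedForest G S
    inducedForest leafIn = hasLeaf⇒acyclic (λ (u∈ , v∈ , a) → v∈ , u∈ , adj-sym a) leaf
      where
      leaf : ∀ {T v} → v ∈ T → HasLeaf (InducedAdj G (Subset._∈ S)) T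
      leaf {T} v∈ with any? (λ u → (u ∈? T) ×-dec ¬? (u ∈ˢ? S))
      ... | yes (u , u∈ , u∉S) = u , u∈ , λ _ _ (u∈S , _) _ → contradiction u∈S u∉S
      ... | no ¬out with leafIn v∈ (λ {p} p∈ → decidable-stable (p ∈ˢ? S) λ p∉ → ¬out (p , p∈ , p∉))
      ...   | u , u∈ , l = u , u∈ , λ p∈ q∈ (_ , _ , a) (_ , _ , b) → l p∈ q∈ a b

    -- Adding `w` to `K` gives a connected subset of `S`, so maximality puts `w` in `K`.
    component-closed : ∀ {K v w} → IsComponent G S K → v Subset.∈ K → w Subset.∈ S → Adj v w → w Subset.∈ K
    component-closed {K} {v} {w} (K⊆S , _ , conn , maximal) v∈ w∈S vw =
      maximal D D⊆S (p⊆p∪q ⁅ w ⁆) connD (q⊆p∪q K ⁅ w ⁆ (x∈⁅x⁆ w))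
      where
      D = K ∪ ⁅ w ⁆

      w∈D : w Subset.∈ D
      w∈D = q⊆p∪q K ⁅ w ⁆ (x∈⁅x⁆ w)

      D⊆S : D ⊆ S
      D⊆S x∈ with x∈p∪q⁻ K ⁅ w ⁆ x∈
      ... | inj₁ x∈K = K⊆S x∈K
      ... | inj₂ x∈w with x∈⁅y⁆⇒x≡y w x∈w
      ...   | refl = w∈S

      viaV : ∀ {x} → x Subset.∈ D → Star (InducedAdj G (Subset._∈ D)) x v × Star (InducedAdj G (Subset._∈ D)) v x
      viaV {x} x∈ with x∈p∪q⁻ K ⁅ w ⁆ x∈
      ... | inj₁ x∈K = map⋆ widen (conn x v x∈K v∈) , map⋆ widen (conn v x v∈ x∈K)
        where
        widen : ∀ {p q} → InducedAdj G (Subset._∈ K) p q → InducedAdj G (Subset._∈ D) p q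
        widen (p∈ , q∈ , a) = p⊆p∪q ⁅ w ⁆ p∈ , p⊆p∪q ⁅ w ⁆ q∈ , a
      ... | inj₂ x∈w with x∈⁅y⁆⇒x≡y w x∈w
      ...   | refl = (w∈D , p⊆p∪q ⁅ w ⁆ v∈ , adj-sym vw) ◅ ε , (p⊆p∪q ⁅ w ⁆ v∈ , w∈D , vw) ◅ ε

      connD : Connected G (Subset._∈ D)
      connD a b a∈ b∈ = proj₁ (viaV a∈) ◅◅ proj₂ (viaV b∈)

  private
    edge? : (K : Subset order) → ∀ e → Dec (
      (proj₁ e Fin.< proj₂ e) × proj₁ e Subset.∈ K × proj₂ e Subset.∈ K × Adj (proj₁ e) (proj₂ e))
    edge? K (u , v) = (u Fin.<? v) ×-dec (u ∈ˢ? K) ×-dec (v ∈ˢ? K) ×-dec adj? u v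

  edges⁺ : ∀ {K u v} → u Subset.∈ K → v Subset.∈ K → Adj u v → (u , v) ∈ edges G K ⊎ (v , u) ∈ edges G K
  edges⁺ {K} {u} {v} u∈ v∈ uv with <-cmp u v
  ... | tri< u<v _ _ = inj₁ (∈-filter⁺ (edge? K) (∈-cartesianProduct⁺ (∈-allFin u) (∈-allFin v)) (u<v , u∈ , v∈ , uv))
  ... | tri≈ _ refl _ = contradiction uv adj-irrefl
  ... | tri> _ _ v<u = inj₂ (∈-filter⁺ (edge? K) (∈-cartesianProduct⁺ (∈-allFin v) (∈-allFin u)) (v<u , v∈ , u∈ , adj-sym uv))

  edges⁻ : ∀ {K u v} → (u , v) ∈ edges G K → (u Fin.< v) × u Subset.∈ K × v Subset.∈ K × Adj u v
  edges⁻ {K} e∈ = proj₂ (∈-filter⁻ (edge? K) {xs = cartesianProduct (allFin _) (allFin _)} e∈)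

  edge⇒1≤edges : ∀ {K u v} → u Subset.∈ K → v Subset.∈ K → Adj u v → 1 ≤ length (edges G K)
  edge⇒1≤edges {K} u∈ v∈ uv with edges G K | edges⁺ u∈ v∈ uv
  ... | _ ∷ _ | _       = s≤s z≤n
  ... | []    | inj₁ ()
  ... | []    | inj₂ ()

  path⇒2≤edges : ∀ {K p q r} → p Subset.∈ K → q Subset.∈ K → r Subset.∈ K →
    Adj p q → Adj q r → p ≢ r → 2 ≤ length (edges G K)
  path⇒2≤edges p∈ q∈ r∈ pq qr p≢r with edges⁺ p∈ q∈ pq | edges⁺ q∈ r∈ qr
  ... | inj₁ e | inj₁ f = two-members e f λ { refl → adj-irrefl pq }
  ... | inj₁ e | inj₂ f = two-members e f λ { refl → p≢r refl }
  ... | inj₂ e | inj₁ f = two-members e f λ { refl → p≢r refl }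
  ... | inj₂ e | inj₂ f = two-members e f λ { refl → adj-irrefl pq }

  -- If neither endpoint of uv has a private neighbour, then {u, v} is a
  -- component of every induced forest containing uv.
  valid⇒distinguished : ∀ {u v} → IsValid G 2 u v → ∃[ s ] (Distinguishes G s u v ⊎ Distinguishes G s v u)
  valid⇒distinguished {u} {v} (S , (forest , strong) , u∈S , v∈S , uv)
    with any? (λ s → distinguishes? G s u v ⊎-dec distinguishes? G s v u)
  ... | yes d = d
  ... | no twins = contradiction (strong K component) (<⇒≱ (s≤s (atMostOne (edges G K) uniqueEdges sameEdges)))
    where
    K = ⁅ u ⁆ ∪ ⁅ v ⁆

    u∈K : u Subset.∈ K
    u∈K = p⊆p∪q ⁅ v ⁆ (x∈⁅x⁆ u)

    v∈K : v Subset.∈ K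
    v∈K = q⊆p∪q ⁅ u ⁆ ⁅ v ⁆ (x∈⁅x⁆ v)

    K⁻ : ∀ {x} → x Subset.∈ K → x ≡ u ⊎ x ≡ v
    K⁻ x∈ with x∈p∪q⁻ ⁅ u ⁆ ⁅ v ⁆ x∈
    ... | inj₁ x∈u = inj₁ (x∈⁅y⁆⇒x≡y u x∈u)
    ... | inj₂ x∈v = inj₂ (x∈⁅y⁆⇒x≡y v x∈v)

    u→v : ∀ {s} → s ≢ v → Adj u s → Adj v s
    u→v {s} s≢v us = decidable-stable (adj? v s) λ ¬vs → twins (s , inj₁ (s≢v , us , ¬vs))

    v→u : ∀ {s} → s ≢ u → Adj v s → Adj u s
    v→u {s} s≢u vs = decidable-stable (adj? u s) λ ¬us → twins (s , inj₂ (s≢u , vs , ¬us))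

    noTriangle : ∀ {s} → s Subset.∈ S → Adj u s → ¬ Adj v s
    noTriangle {s} s∈S us vs = forest (u , v ∷ s ∷ [] , s≤s (s≤s z≤n) ,
      ((λ { refl → adj-irrefl uv }) ∷ (λ { refl → adj-irrefl us }) ∷ []) ∷
      ((λ { refl → adj-irrefl vs }) ∷ []) ∷ [] ∷ [] ,
      (u∈S , v∈S , uv) ∷ (v∈S , s∈S , vs) ∷ (s∈S , u∈S , adj-sym us) ∷ [-])

    trapped : ∀ {D a d} → D ⊆ S → a Subset.∈ K → Star (InducedAdj G (Subset._∈ D)) a d → d Subset.∈ K
    trapped D⊆S a∈ ε = a∈
    trapped {a = a} D⊆S a∈ (_◅_ {j = b} (_ , b∈ , ab) rs) with b ≟ u | b ≟ v
    ... | yes refl | _        = trapped D⊆S u∈K rs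
    ... | no _     | yes refl = trapped D⊆S v∈K rs
    -- A step out of `K` would reach a common neighbour of `u` and `v` and close a triangle in the
    -- forest.
    ... | no b≢u   | no b≢v with K⁻ a∈
    ...   | inj₁ refl = contradiction (u→v b≢v ab) (noTriangle (D⊆S b∈) ab)
    ...   | inj₂ refl = contradiction ab (noTriangle (D⊆S b∈) (v→u b≢u ab))

    component : IsComponent G S K
    component = K⊆S , (u , u∈K) , connected ,
      λ D D⊆S K⊆D conn {d} d∈ → trapped D⊆S u∈K (conn u d (K⊆D u∈K) d∈)
      where
      K⊆S : K ⊆ S
      K⊆S x∈ with K⁻ x∈
      ... | inj₁ refl = u∈S
      ... | inj₂ refl = v∈S

      connected : Connected G (Subset._∈ K)
      connected a b a∈ b∈ with K⁻ a∈ | K⁻ b∈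
      ... | inj₁ refl | inj₁ refl = ε
      ... | inj₁ refl | inj₂ refl = (u∈K , v∈K , uv) ◅ ε
      ... | inj₂ refl | inj₁ refl = (v∈K , u∈K , adj-sym uv) ◅ ε
      ... | inj₂ refl | inj₂ refl = ε

    sameEdges : ∀ {e f} → e ∈ edges G K → f ∈ edges G K → e ≡ f
    sameEdges {a , b} {a′ , b′} e∈ f∈ with edges⁻ e∈ | edges⁻ f∈
    ... | a<b , a∈ , b∈ , ab | a′<b′ , a′∈ , b′∈ , ab′ with K⁻ a∈ | K⁻ b∈ | K⁻ a′∈ | K⁻ b′∈
    ...   | inj₁ refl | inj₁ refl | _ | _ = contradiction ab adj-irrefl
    ...   | inj₂ refl | inj₂ refl | _ | _ = contradiction ab adj-irrefl
    ...   | _ | _ | inj₁ refl | inj₁ refl = contradiction ab′ adj-irrefl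
    ...   | _ | _ | inj₂ refl | inj₂ refl = contradiction ab′ adj-irrefl
    ...   | inj₁ refl | inj₂ refl | inj₁ refl | inj₂ refl = refl
    ...   | inj₂ refl | inj₁ refl | inj₂ refl | inj₁ refl = refl
    ...   | inj₁ refl | inj₂ refl | inj₂ refl | inj₁ refl = contradiction a′<b′ (<-asym a<b)
    ...   | inj₂ refl | inj₁ refl | inj₁ refl | inj₂ refl = contradiction a′<b′ (<-asym a<b)

    uniqueEdges : Unique (edges G K)
    uniqueEdges = Uniqueₚ.filter⁺ (edge? K) (Uniqueₚ.cartesianProduct⁺ (Uniqueₚ.allFin⁺ order) (Uniqueₚ.allFin⁺ order))

    atMostOne : ∀ xs → Unique xs → (∀ {e f : Vertex × Vertex} → e ∈ xs → f ∈ xs → e ≡ f) → length xs ≤ 1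
    atMostOne []           _ _ = z≤n
    atMostOne (_ ∷ [])     _ _ = s≤s z≤n
    atMostOne (_ ∷ _ ∷ _) ((x≢y ∷ _) ∷ _) same = contradiction (same (here refl) (there (here refl))) x≢y

-- Missing colours, and sets of two or three colours

missingColour : ∀ {c : A → Fin 3} {u v p} → NonRainbow c u v p → ∃[ i ] (c u ≢ i × c v ≢ i × c p ≢ i)
missingColour {c = c} {u} {v} {p} = toWitness {a? = all? λ a → all? λ b → all? λ d →
  ((a ≟ b) ⊎-dec (a ≟ d) ⊎-dec (b ≟ d)) →-dec any? λ i → ¬? (a ≟ i) ×-dec ¬? (b ≟ i) ×-dec ¬? (d ≟ i)}
  _ (c u) (c v) (c p)

missing⇒nonRainbow : ∀ {c : A → Fin 3} i u v p → c u ≢ i → c v ≢ i → c p ≢ i → NonRainbow c u v p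
missing⇒nonRainbow {c = c} i u v p = toWitness {a? = all? λ i → all? λ a → all? λ b → all? λ d →
  ¬? (a ≟ i) →-dec ¬? (b ≟ i) →-dec ¬? (d ≟ i) →-dec ((a ≟ b) ⊎-dec (a ≟ d) ⊎-dec (b ≟ d))}
  _ i (c u) (c v) (c p)

∣a,b∣≤2 : ∀ (a b : Fin n) → ∣ ⁅ a ⁆ ∪ ⁅ b ⁆ ∣ ≤ 2
∣a,b∣≤2 a b = ≤-trans (∣p∪q∣≤∣p∣+∣q∣ ⁅ a ⁆ ⁅ b ⁆) (≤-reflexive (cong₂ _+_ (∣⁅x⁆∣≡1 a) (∣⁅x⁆∣≡1 b)))

choose-pair : ∀ {n} → 2 ≤ n → (a b : Fin n) →
  Any (λ T → a Subset.∈ proj₁ T × b Subset.∈ proj₁ T) (choose n 2)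
choose-pair 2≤n a b = Any.map
  (λ {T} (S⊆T : ⁅ a ⁆ ∪ ⁅ b ⁆ ⊆ proj₁ T) →
    S⊆T (p⊆p∪q ⁅ b ⁆ (x∈⁅x⁆ a)) , S⊆T (q⊆p∪q ⁅ a ⁆ ⁅ b ⁆ (x∈⁅x⁆ b)))
  (choose-covers (⁅ a ⁆ ∪ ⁅ b ⁆) (∣a,b∣≤2 a b) 2≤n)

choose-triple : ∀ {n} → 3 ≤ n → (a b d : Fin n) →
  Any (λ T → a Subset.∈ proj₁ T × b Subset.∈ proj₁ T × d Subset.∈ proj₁ T) (choose n 3)
choose-triple 3≤n a b d = Any.map
  (λ {T} (S⊆T : (⁅ a ⁆ ∪ ⁅ b ⁆) ∪ ⁅ d ⁆ ⊆ proj₁ T) →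
    S⊆T (p⊆p∪q ⁅ d ⁆ (p⊆p∪q ⁅ b ⁆ (x∈⁅x⁆ a))) ,
    S⊆T (p⊆p∪q ⁅ d ⁆ (q⊆p∪q ⁅ a ⁆ ⁅ b ⁆ (x∈⁅x⁆ b))) ,
    S⊆T (q⊆p∪q (⁅ a ⁆ ∪ ⁅ b ⁆) ⁅ d ⁆ (x∈⁅x⁆ d)))
  (choose-covers ((⁅ a ⁆ ∪ ⁅ b ⁆) ∪ ⁅ d ⁆)
    (≤-trans (∣p∪q∣≤∣p∣+∣q∣ (⁅ a ⁆ ∪ ⁅ b ⁆) ⁅ d ⁆)
      (+-mono-≤ (∣a,b∣≤2 a b) (≤-reflexive (∣⁅x⁆∣≡1 d)))) 3≤n)

length-cartesianProductWith : ∀ {A B D : Set} (f : A → B → D) xs ys →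
  length (cartesianProductWith f xs ys) ≡ length xs * length ys
length-cartesianProductWith f []       ys = refl
length-cartesianProductWith f (x ∷ xs) ys = trans (length-++ (map (f x) ys))
  (cong₂ _+_ (length-map (f x) ys) (length-cartesianProductWith f xs ys))

twoElements : ∀ {T : Subset n} → ∣ T ∣ ≡ 2 → ∃[ a ] ∃[ b ] (∀ {x} → x Subset.∈ T → x ≡ a ⊎ x ≡ b)
twoElements {T = T} two with elements T | trans (length-elements T) two | (λ {x} → ∈-elements⁺ {S = T} {x})
... | a ∷ b ∷ [] | _ | within = a , b , λ x∈ → member (within x∈)
  where
  member : ∀ {x} → x ∈ a ∷ b ∷ [] → x ≡ a ⊎ x ≡ b
  member (here e)         = inj₁ e
  member (there (here e)) = inj₂ e

-- Forests from colour classes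

module ColourClasses (G : Graph) {k : ℕ} (D : BagDecomposition k G) {t : ℕ}
  (col : Graph.Vertex G → Fin t) (injective : All (InjectiveOn col) (BagDecomposition.bags D)) where
  open Graph G
  open BagDecomposition D

  module _ (T : Subset t) where

    -- The other vertices stay as isolated ones, so that the vertex type does not change.
    restrict : Graph
    restrict = record
      { order      = order
      ; Adj        = λ u v → Adj u v × col u Subset.∈ T × col v Subset.∈ T
      ; adj?       = λ u v → adj? u v ×-dec (col u ∈ˢ? T) ×-dec (col v ∈ˢ? T)
      ; adj-sym    = λ (a , u∈ , v∈) → adj-sym a , v∈ , u∈
      ; adj-irrefl = adj-irrefl ∘ proj₁
      }

    coloured : Fin t → List Vertex → List Vertex
    coloured a B = filter (λ v → col v ≟ a) B

    -- One vertex per colour bounds the length by the number of colours even if a bag repeats a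
    -- vertex; on a bag with injective colouring nothing is lost.
    restrictBag : List Vertex → List Vertex
    restrictBag B = concatMap (λ a → take 1 (coloured a B)) (elements T)

    length-restrictBag : ∀ B → length (restrictBag B) ≤ ∣ T ∣
    length-restrictBag B = ≤-trans (bound (elements T)) (≤-reflexive (length-elements T))
      where
      bound : ∀ as → length (concatMap (λ a → take 1 (coloured a B)) as) ≤ length as
      bound []       = z≤n
      bound (a ∷ as) = ≤-trans (≤-reflexive (length-++ (take 1 (coloured a B))))
        (+-mono-≤ (≤-trans (≤-reflexive (length-take 1 (coloured a B))) (m⊓n≤m 1 _)) (bound as))

    restrictBag-⇔ : ∀ {B} → InjectiveOn col B → ∀ {v} →
      (v ∈ restrictBag B → v ∈ B × col v Subset.∈ T) × (v ∈ B → col v Subset.∈ T → v ∈ restrictBag B)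
    restrictBag-⇔ {B} inj {v} = to , from
      where
      take-⊆ : ∀ {xs : List Vertex} → v ∈ take 1 xs → v ∈ xs
      take-⊆ {_ ∷ _} (here e) = here e

      to : v ∈ restrictBag B → v ∈ B × col v Subset.∈ T
      to v∈ with find (∈-concatMap⁻ (λ a → take 1 (coloured a B)) {xs = elements T} v∈)
      ... | a , a∈ , v∈a with ∈-filter⁻ (λ v → col v ≟ a) {xs = B} (take-⊆ v∈a)
      ...   | v∈B , refl = v∈B , ∈-elements⁻ T a∈

      first : ∀ xs → (∀ {w} → w ∈ xs → w ≡ v) → v ∈ xs → v ∈ take 1 xs
      first (x ∷ xs) all≡ _ = here (sym (all≡ (here refl)))

      from : v ∈ B → col v Subset.∈ T → v ∈ restrictBag B
      from v∈B cv∈T = ∈-concatMap⁺ (λ a → take 1 (coloured a B)) (lose (∈-elements⁺ cv∈T)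
        (first (coloured (col v) B)
          (λ w∈ → let w∈B , eq = ∈-filter⁻ (λ w → col w ≟ col v) {xs = B} w∈ in inj w∈B v∈B eq)
          (∈-filter⁺ (λ w → col w ≟ col v) v∈B refl)))

    restrictDecomposition : BagDecomposition ∣ T ∣ restrict
    restrictDecomposition = record
      { bags    = map restrictBag bags
      ; running = runningIntersection-restrict (λ v → col v Subset.∈ T) restrictBag
                    (All.map restrictBag-⇔ injective) running
      ; short   = Allₚ.map⁺ (All.tabulate λ {B} _ → length-restrictBag B)
      ; cover   = λ (uv , u∈T , v∈T) → let B , B∈ , u∈ , v∈ = find (cover uv)
                                           inj = All.lookup injective B∈
                  in lose (∈-map⁺ restrictBag B∈)
                       (proj₂ (restrictBag-⇔ inj) u∈ u∈T , proj₂ (restrictBag-⇔ inj) v∈ v∈T)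
      }

    open Graph restrict using () renaming (Adj to Adjᵀ; adj? to adjᵀ?; adj-sym to symᵀ)

    nonIsolated? : ∀ v → Dec (∃[ w ] Adjᵀ v w)
    nonIsolated? v = any? (adjᵀ? v)

    nonIsolated : Subset order
    nonIsolated = fromPred nonIsolated?

    nonIsolated-strong : ∣ T ∣ ≡ 2 → IsStrongForest G 1 nonIsolated
    nonIsolated-strong two = inducedForest G leaf , strong
      where
      leaf : ∀ {S v} → v ∈ S → (∀ {p} → p ∈ S → p Subset.∈ nonIsolated) → HasLeaf Adj S
      leaf v∈ within with twoElements two
      ... | a , b , ab = twoColoured⇒hasLeaf adj-irrefl running injective v∈
        (twoOf⇒twoColoured λ p∈ → let _ , _ , cp∈T , _ = ∈-fromPred⁻ nonIsolated? (within p∈) in ab cp∈T)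
        λ _ _ → cover

      strong : ∀ K → IsComponent G nonIsolated K → 1 ≤ length (edges G K)
      strong K comp@(K⊆ , (v , v∈) , _) with ∈-fromPred⁻ nonIsolated? (K⊆ v∈)
      ... | w , vw = edge⇒1≤edges G v∈
        (component-closed G comp v∈ (∈-fromPred⁺ nonIsolated? (v , symᵀ vw)) (proj₁ vw)) (proj₁ vw)

    module _ (good : GoodColouring restrict) (i : Fin 3) where
      open GoodColouring good renaming (colour to c; leaf to leafᵀ)

      IsPath : Vertex → Vertex → Vertex → Set
      IsPath p q r = Adjᵀ p q × Adjᵀ q r × p ≢ r × c p ≢ i × c q ≢ i × c r ≢ i

      OnPath : Vertex → Set
      OnPath v = ∃[ p ] ∃[ q ] ∃[ r ] (IsPath p q r × v ∈ p ∷ q ∷ r ∷ [])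

      onPath? : Decidable OnPath
      onPath? v = any? λ p → any? λ q → any? λ r →
        (adjᵀ? p q ×-dec adjᵀ? q r ×-dec ¬? (p ≟ r) ×-dec
          ¬? (c p ≟ i) ×-dec ¬? (c q ≟ i) ×-dec ¬? (c r ≟ i)) ×-dec
        (v ∈? (p ∷ q ∷ r ∷ []))

      -- This is the forest on the two classes other than `i`, without its components of at most one
      -- edge.
      onPaths : Subset order
      onPaths = fromPred onPath?

      onPath⇒allowed : ∀ {v} → OnPath v → c v ≢ i × col v Subset.∈ T
      onPath⇒allowed (p , q , r , ((_ , p∈ , q∈) , (_ , _ , r∈) , _ , cp , cq , cr) , v∈) = at v∈
        where
        at : ∀ {v} → v ∈ p ∷ q ∷ r ∷ [] → c v ≢ i × col v Subset.∈ T
        at (here refl)                 = cp , p∈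
        at (there (here refl))         = cq , q∈
        at (there (there (here refl))) = cr , r∈

      onPaths-strong : IsStrongForest G 2 onPaths
      onPaths-strong = inducedForest G leaf , strong
        where
        leaf : ∀ {S v} → v ∈ S → (∀ {p} → p ∈ S → p Subset.∈ onPaths) → HasLeaf Adj S
        leaf v∈ within with leafᵀ v∈ (λ {p} {q} {r} p∈ q∈ r∈ → missing⇒nonRainbow i p q r
            (proj₁ (allowed p∈)) (proj₁ (allowed q∈)) (proj₁ (allowed r∈)))
          where
          allowed : ∀ {p} → p ∈ _ → c p ≢ i × col p Subset.∈ T
          allowed p∈ = onPath⇒allowed (∈-fromPred⁻ onPath? (within p∈))
        ... | u , u∈ , l = u , u∈ , λ p∈ q∈ a b →
          l p∈ q∈ (a , allowed u∈ , allowed p∈) (b , allowed u∈ , allowed q∈)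
          where
          allowed : ∀ {p} → p ∈ _ → col p Subset.∈ T
          allowed p∈ = proj₂ (onPath⇒allowed (∈-fromPred⁻ onPath? (within p∈)))

        strong : ∀ K → IsComponent G onPaths K → 2 ≤ length (edges G K)
        strong K comp@(K⊆ , (v , v∈) , _) with ∈-fromPred⁻ onPath? (K⊆ v∈)
        ... | p , q , r , path@(pq , qr , p≢r , _) , v∈path = at v∈path
          where
          kept : ∀ {w} → w ∈ p ∷ q ∷ r ∷ [] → w Subset.∈ onPaths
          kept w∈ = ∈-fromPred⁺ onPath? (p , q , r , path , w∈)

          closed : ∀ {w x} → w Subset.∈ K → x ∈ p ∷ q ∷ r ∷ [] → Adj w x → x Subset.∈ K
          closed w∈ x∈ = component-closed G comp w∈ (kept x∈)

          fromMiddle : q Subset.∈ K → 2 ≤ length (edges G K)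
          fromMiddle q∈ = path⇒2≤edges G
            (closed q∈ (here refl) (adj-sym (proj₁ pq))) q∈ (closed q∈ (there (there (here refl))) (proj₁ qr))
            (proj₁ pq) (proj₁ qr) p≢r

          at : v ∈ p ∷ q ∷ r ∷ [] → 2 ≤ length (edges G K)
          at (here refl)                 = fromMiddle (closed v∈ (there (here refl)) (proj₁ pq))
          at (there (here refl))         = fromMiddle v∈
          at (there (there (here refl))) = fromMiddle (closed v∈ (there (here refl)) (adj-sym (proj₁ qr)))

    -- As `T` contains the colour of `s`, the edge is still distinguished in the restriction and
    -- extends to a path there; a colour missing on that path selects the forest.
    onPaths-covers : ∀ (good : GoodColouring restrict) {u v s} → Distinguishes G s u v → Adj u v →
      col u Subset.∈ T × col v Subset.∈ T × col s Subset.∈ T → ∃[ i ] EdgeIn G u v (onPaths good i)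
    onPaths-covers good {u} {v} {s} (s≢v , us , ¬vs) uv (u∈ , v∈ , s∈)
      with GoodColouring.extended good {s = s} (uv , u∈ , v∈) (s≢v , (us , u∈ , s∈) , ¬vs ∘ proj₁)
    ... | p , p≢u , p≢v , near , nr with missingColour {c = GoodColouring.colour good} nr
    ...   | i , cu , cv , cp = i , both near
      where
      both : Adjᵀ u p ⊎ Adjᵀ v p → EdgeIn G u v (onPaths good i)
      both (inj₁ up) = ∈-fromPred⁺ (onPath? good i) (p , u , v , path , there (here refl)) ,
                       ∈-fromPred⁺ (onPath? good i) (p , u , v , path , there (there (here refl))) , uv
        where path = symᵀ up , (uv , u∈ , v∈) , p≢v , cp , cu , cv
      both (inj₂ vp) = ∈-fromPred⁺ (onPath? good i) (u , v , p , path , here refl) ,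
                       ∈-fromPred⁺ (onPath? good i) (u , v , p , path , there (here refl)) , uv
        where path = (uv , u∈ , v∈) , vp , p≢u ∘ sym , cu , cv , cp

  -- The two bounds

  f₁≤ : 2 ≤ t → strongInducedArboricity 1 G ≤ t C 2
  f₁≤ 2≤t = arboricity≤ G (map (nonIsolated ∘ proj₁) (choose t 2))
    (trans (length-map (nonIsolated ∘ proj₁) (choose t 2)) (length-choose t 2))
    (Allₚ.map⁺ (All.tabulate λ {T} _ → nonIsolated-strong (proj₁ T) (proj₂ T)))
    λ { u v (_ , _ , _ , _ , uv) → Anyₚ.map⁺ (Any.map
          (λ {T} (u∈ , v∈) → ∈-fromPred⁺ (nonIsolated? (proj₁ T)) (v , uv , u∈ , v∈) ,
                             ∈-fromPred⁺ (nonIsolated? (proj₁ T)) (u , adj-sym uv , v∈ , u∈) , uv)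
          (choose-pair 2≤t (col u) (col v))) }

  f₂≤ : 3 ≤ t → strongInducedArboricity 2 G ≤ 3 * (t C 3)
  f₂≤ 3≤t = arboricity≤ G forests
    (trans (length-cartesianProductWith forest (choose t 3) (allFin 3))
      (trans (*-comm (length (choose t 3)) 3) (cong (3 *_) (length-choose t 3))))
    (All.tabulate strong)
    covers
    where
    good : (T : Σ[ T ∈ Subset t ] ∣ T ∣ ≡ 3) → GoodColouring (restrict (proj₁ T))
    good (T , three) = goodColouring order (restrict T)
      (subst (λ m → BagDecomposition m (restrict T)) three (restrictDecomposition T))
      (allFin order) (λ _ → ∈-allFin _) (≤-reflexive (length-tabulate id))

    forest : (Σ[ T ∈ Subset t ] ∣ T ∣ ≡ 3) → Fin 3 → Subset order
    forest T = onPaths (proj₁ T) (good T)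

    forests : List (Subset order)
    forests = cartesianProductWith forest (choose t 3) (allFin 3)

    strong : ∀ {F} → F ∈ forests → IsStrongForest G 2 F
    strong F∈ with ∈-cartesianProductWith⁻ forest (choose t 3) (allFin 3) F∈
    ... | T , i , _ , _ , refl = onPaths-strong (proj₁ T) (good T) i

    oriented : ∀ {u v s} → Distinguishes G s u v → Adj u v → Any (EdgeIn G u v) forests
    oriented {u} {v} {s} d uv =
      let T , T∈ , within = find (choose-triple 3≤t (col u) (col v) (col s))
          i , edge = onPaths-covers (proj₁ T) (good T) d uv within
      in lose (∈-cartesianProductWith⁺ forest T∈ (∈-allFin i)) edge

    covers : ∀ u v → IsValid G 2 u v → Any (EdgeIn G u v) forests
    covers u v valid@(_ , _ , _ , _ , uv) with valid⇒distinguished G valid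
    ... | _ , inj₁ d = oriented d uv
    ... | _ , inj₂ d = Any.map (λ (v∈ , u∈ , vu) → u∈ , v∈ , adj-sym vu) (oriented d (adj-sym uv))

theorem5 : (G : Graph) (t : ℕ) → 2 ≤ t → HasTreeWidth G t →
    strongInducedArboricity 1 G ≤ (t + 1) C 2 ×
    strongInducedArboricity 2 G ≤ 3 * ((t + 1) C 3)
theorem5 G t 2≤t ((D , refl) , _) =
  subst (λ s → strongInducedArboricity 1 G ≤ s C 2 × strongInducedArboricity 2 G ≤ 3 * (s C 3))
    (+-comm 1 t) (f₁≤ (s≤s (≤-trans (s≤s z≤n) 2≤t)) , f₂≤ (s≤s 2≤t))
  where
  bagDec = FromTree.bagDecomposition D
  colouring = bagColouring (BagDecomposition.running bagDec) (BagDecomposition.short bagDec)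
  open ColourClasses G bagDec (proj₁ colouring) (proj₂ colouring)
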